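{- Let $n\ge 1$. There exists a listing $\pi_0,\pi_1,\ldots,\pi_{n!-1}$ of all permutations of $\{1,2,\ldots,n\}$ (written as words) such that consecutive permutations $\pi_i,\pi_{i+1}$ differ by interchanging the symbols in two adjacent positions, and $\pi_{i+n!/2}$ is the reversal of $\pi_i$ for all $0\le i<n!/2$, if and only if $n\le 4$ or $n\equiv 0,1 \pmod 4$.
   Context: The reversal of a word $a_1a_2\cdots a_n$ is $a_na_{n-1}\cdots a_1$. Such a listing is called a reverse (adjacent interchange) Gray code for permutations of $12\ldots n$. -}

module Defs where

open import Data.Fin using (Fin; toℕ)
open import Data.List using (List; _∷_; _++_; applyUpTo; reverse)
open import Data.List.Relation.Binary.Permutation.Propositional using (_↭_)
open import Data.Nat using (ℕ; suc; _+_; _<_; _/_; _!)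
open import Data.Product using (_×_; ∃-syntax)
open import Function.Definitions using (Injective)
open import Relation.Binary.PropositionalEquality using (_≡_)

Word : Set
Word = List ℕ

-- applyUpTo suc n is the word 1 2 … n.
IsPermutation : ℕ → Word → Set
IsPermutation n w = w ↭ applyUpTo suc n

AdjacentInterchange : Word → Word → Set
AdjacentInterchange u v =
  ∃[ xs ] ∃[ a ] ∃[ b ] ∃[ ys ]
    (u ≡ xs ++ a ∷ b ∷ ys) × (v ≡ xs ++ b ∷ a ∷ ys)

record IsReverseGrayCode (n : ℕ) (π : Fin (n !) → Word) : Set where
  field
    permutation : ∀ i → IsPermutation n (π i)
    injective   : Injective _≡_ _≡_ π
    exhaustive  : ∀ w → IsPermutation n w → ∃[ i ] π i ≡ w
    adjacent    : ∀ i j → toℕ j ≡ suc (toℕ i) →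
                  AdjacentInterchange (π i) (π j)
    -- _/_ rounds down, so for n = 1, where n ! is odd, no i satisfies the
    -- bound and the condition is vacuous.
    reversal    : ∀ i j → toℕ i < n ! / 2 → toℕ j ≡ toℕ i + n ! / 2 →
                  π j ≡ reverse (π i)

{-# OPTIONS --safe #-}

-- Reversal changes the sign of a permutation by the parity of n(n-1)/2, whereas
-- n!/2 adjacent interchanges do not change it when n ≥ 4.  This excludes
-- n ≡ 2 , 3 (mod 4) for n > 4.
--
-- Conversely, the words in which 1 precedes 2 contain exactly one of each word
-- and its reversal.  A Hamiltonian path through these words from rev σ 1 2 to
-- 1 2 σ can be continued by its own reversal, because 1 2 σ and the reversal
-- 2 1 σ of the starting word are adjacent.  Such a path visits the classes of
-- words with a common first letter one after the other; one passes from the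
-- class of c to the class of d through c d w and d c w.  Each class is again
-- such a set of words on fewer letters, except that the constraint disappears
-- in the class of 1.  Inside the classes one only has to reach some word with a
-- prescribed first letter; the class of 1 is visited last, where by a similar
-- induction (Tchuente's theorem) any two words of opposite sign with distinct
-- first letters are joined by a Hamiltonian path.  The bases of the inductions
-- are 5 letters with the constraint and 4 letters without it.
module Submission where

open import Data.Digit using (toNatDigits)
open import Data.Empty using (⊥)
open import Data.Fin as Fin using (Fin; fromℕ<; toℕ)
open import Data.Fin.Properties using (toℕ-fromℕ<; toℕ-injective; toℕ<n)
open import Data.List using
  (List; []; [_]; _++_; _∷_; _∷ʳ_; applyUpTo; concatMap; filter; head; length; map;
   reverse)
open import Data.List.Membership.Propositional using (_∈_; find)
open import Data.List.Membership.Propositional.Properties using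
  (∈-++⁺ʳ; ∈-++⁺ˡ; ∈-++⁻; ∈-concatMap⁺; ∈-concatMap⁻; ∈-map⁺; ∈-map⁻; ∈-∃++)
open import Data.List.Properties using
  (++-assoc; filter-accept; filter-reject; length-++; length-applyUpTo; length-map;
   map-++; map-∘; reverse-++; reverse-involutive; unfold-reverse; ∷-injectiveʳ; ≡-dec)
open import Data.List.Relation.Binary.Permutation.Propositional using
  (_↭_; prep; refl; swap; trans; ↭-sym; ↭⇒↭ₛ)
open import Data.List.Relation.Binary.Permutation.Propositional.Properties using
  (++-comm; ++⁺; ++⁺ʳ; ++⁺ˡ; All-resp-↭; drop-∷; filter-↭; shift; ↭-empty-inv; ↭-length;
   ↭-reverse; ↭-singleton-inv; ∈-resp-↭; ∷↭∷ʳ)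
  renaming (map⁺ to ↭-map⁺)
import Data.List.Relation.Binary.Permutation.Setoid.Properties as Permutationₛ
open import Data.List.Relation.Unary.All as All using (All; []; _∷_; all?; lookup; tabulate)
open import Data.List.Relation.Unary.AllPairs using ([]; _∷_)
open import Data.List.Relation.Unary.Any as Any using (Any; any?; here; there)
open import Data.List.Relation.Unary.Unique.Propositional using (Unique)
import Data.List.Relation.Unary.Unique.Propositional.Properties as Unique
open import Data.Maybe using (just)
import Data.Maybe.Properties as Maybe
open import Data.Nat using
  (_!; _%_; _*_; _+_; _/_; _<?_; _<_; _≟_; _≤?_; _≤_; parity; suc; s≤s; s≤s⁻¹; zero; z≤n;
   ℕ)
open import Data.Nat.DivMod using (m%n<n; m*n/n≡m; m/n<m; m≡m%n+[m/n]*n; m≥n⇒m/n>0)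
open import Data.Nat.Divisibility using (divides; m≤n⇒m!∣n!; ∣⇒≤)
open import Data.Nat.ListAction using (sum)
open import Data.Nat.ListAction.Properties using (sum-↭)
open import Data.Nat.Properties using
  (*-assoc; *-comm; *-distribˡ-+; +-assoc; +-comm; +-identityʳ; +-suc; <-asym; <-cmp;
   <-trans; <⇒≢; <⇒≤; _!≢0; m≤m+n; n<1+n; n≤1+n; suc-injective; ≤-<-trans; ≤-reflexive;
   ≤-trans; ≰⇒>)
open import Data.Parity.Base as ℙ using (0ℙ; 1ℙ; Parity; _⁻¹)
import Data.Parity.Properties as ℙ
open import Data.Product using (_,_; _×_; map₂; proj₁; proj₂; ∃; ∃₂; ∃-syntax)
open import Data.Sum using (_⊎_; inj₁; inj₂)
open import Function using (_∘_; id)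
open import Function.Bundles using (_⇔_; mk⇔)
open import Relation.Binary using (DecidableEquality; tri<; tri>; tri≈)
open import Relation.Binary.PropositionalEquality using
  (_≡_; _≢_; cong; cong₂; module ≡-Reasoning; refl; setoid; subst; subst₂; sym)
  renaming (trans to ≡-trans)
open import Relation.Nullary using (Dec; _×-dec_; _⊎-dec_; contradiction; no; yes)
open import Relation.Nullary.Decidable using (from-yes; map′)
open import Relation.Unary using (Decidable)
open import Defs

-- Adjacent interchanges and walks

variable
  a b c d : ℕ
  u v w A B : Word
  us vs ws : List Word

interchange-first : AdjacentInterchange (a ∷ b ∷ w) (b ∷ a ∷ w)
interchange-first = [] , _ , _ , _ , refl , refl

interchange-∷ : AdjacentInterchange u v → AdjacentInterchange (c ∷ u) (c ∷ v)
interchange-∷ (xs , a , b , ys , refl , refl) = _ ∷ xs , a , b , ys , refl , refl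

interchange-map : (f : ℕ → ℕ) → AdjacentInterchange u v → AdjacentInterchange (map f u) (map f v)
interchange-map f (xs , a , b , ys , refl , refl) =
  map f xs , f a , f b , map f ys , map-++ f xs _ , map-++ f xs _

interchange-∷ʳ : AdjacentInterchange u v → AdjacentInterchange (u ∷ʳ c) (v ∷ʳ c)
interchange-∷ʳ (xs , a , b , ys , refl , refl) = xs , a , b , ys ∷ʳ _ , ++-assoc xs _ _ , ++-assoc xs _ _

interchange-reverse : AdjacentInterchange u v → AdjacentInterchange (reverse u) (reverse v)
interchange-reverse (xs , a , b , ys , refl , refl) =
  reverse ys , b , a , reverse xs , reversal a b , reversal b a
  where
  reversal : ∀ a b → reverse (xs ++ a ∷ b ∷ ys) ≡ reverse ys ++ b ∷ a ∷ reverse xs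
  reversal a b = begin
    reverse (xs ++ a ∷ b ∷ ys)                   ≡⟨ reverse-++ xs _ ⟩
    reverse (a ∷ b ∷ ys) ++ reverse xs           ≡⟨ cong (_++ reverse xs) (reverse-++ (a ∷ b ∷ []) ys) ⟩
    (reverse ys ++ b ∷ a ∷ []) ++ reverse xs     ≡⟨ ++-assoc (reverse ys) _ _ ⟩
    reverse ys ++ b ∷ a ∷ reverse xs             ∎
    where open ≡-Reasoning

interchange⇒↭ : AdjacentInterchange u v → u ↭ v
interchange⇒↭ (xs , a , b , ys , refl , refl) = ++⁺ˡ xs (swap a b refl)

-- The list records every word of the walk except the last one.
data Walk : Word → Word → List Word → Set where
  ε   : Walk u u []
  _◅_ : AdjacentInterchange u v → Walk v w ws → Walk u w (u ∷ ws)

_◅◅_ : Walk u v us → Walk v w vs → Walk u w (us ++ vs)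
ε       ◅◅ q = q
(s ◅ p) ◅◅ q = s ◅ (p ◅◅ q)

_▻_ : Walk u v ws → AdjacentInterchange v w → Walk u w (ws ∷ʳ v)
p ▻ s = p ◅◅ (s ◅ ε)

walk-map : (f : Word → Word) → (∀ {u v} → AdjacentInterchange u v → AdjacentInterchange (f u) (f v)) →
           Walk u v ws → Walk (f u) (f v) (map f ws)
walk-map f f⁺ ε       = ε
walk-map f f⁺ (s ◅ p) = f⁺ s ◅ walk-map f f⁺ p

Unique-resp-↭ : ∀ {X : Set} {xs ys : List X} → xs ↭ ys → Unique xs → Unique ys
Unique-resp-↭ p = Permutationₛ.Unique-resp-↭ (setoid _) (↭⇒↭ₛ p)

-- Signs and reversals

below : ℕ → Word → ℕ
below a w = length (filter (_<? a) w)

-- Defined for arbitrary words of numbers, so that signs make sense on the sub-alphabets that occur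
-- inside the classes.
inversions : Word → ℕ
inversions []      = 0
inversions (a ∷ w) = below a w + inversions w

sign : Word → Parity
sign w = parity (inversions w)

parity-suc : ∀ n → parity (suc n) ≡ parity n ⁻¹
parity-suc n = ≡-trans (sym (ℙ.⁻¹-involutive _)) (cong _⁻¹ (ℙ.suc-homo-⁻¹ n))

below-↭ : ∀ a → u ↭ v → below a u ≡ below a v
below-↭ a p = ↭-length (filter-↭ (_<? a) p)

sign-∷ : ∀ a w → sign (a ∷ w) ≡ parity (below a w) ℙ.+ sign w
sign-∷ a w = ℙ.+-homo-+ (below a w) (inversions w)

+-⁻¹ : ∀ p q → p ℙ.+ q ⁻¹ ≡ (p ℙ.+ q) ⁻¹
+-⁻¹ 0ℙ q = refl
+-⁻¹ 1ℙ q = refl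

⁻¹-+ : ∀ p q → p ⁻¹ ℙ.+ q ≡ (p ℙ.+ q) ⁻¹
⁻¹-+ 0ℙ q = refl
⁻¹-+ 1ℙ q = sym (ℙ.⁻¹-involutive q)

-- Both orders count `below a w + below b w` pairs with `w`, so only the pair itself makes a
-- difference.
below-inversions : a < b → inversions (b ∷ a ∷ w) ≡ suc (inversions (a ∷ b ∷ w))
below-inversions {a} {b} {w} a<b
  rewrite filter-accept (_<? b) {x = a} {xs = w} a<b
        | filter-reject (_<? a) {x = b} {xs = w} (<-asym a<b)
  = cong suc (begin
      below b w + (below a w + inversions w)   ≡⟨ +-assoc (below b w) _ _ ⟨
      below b w + below a w + inversions w     ≡⟨ cong (_+ inversions w) (+-comm (below b w) (below a w)) ⟩
      below a w + below b w + inversions w     ≡⟨ +-assoc (below a w) _ _ ⟩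
      below a w + (below b w + inversions w)   ∎)
  where open ≡-Reasoning

-- A letter in front of the interchanged pair has the same smaller letters behind it before and
-- after, which reduces the claim to a pair at the front. Distinctness excludes `a ≡ b`, where the
-- sign would not change.
interchange-sign : Unique u → AdjacentInterchange u v → sign v ≡ sign u ⁻¹
interchange-sign ((a≢b ∷ _) ∷ _) ([] , a , b , ys , refl , refl) with <-cmp a b
... | tri< a<b _ _ = ≡-trans (cong parity (below-inversions a<b)) (parity-suc (inversions (a ∷ b ∷ ys)))
... | tri≈ _ a≡b _ = contradiction a≡b a≢b
... | tri> _ _ b<a =
  sym (≡-trans (cong (_⁻¹ ∘ parity) (below-inversions b<a)) (ℙ.suc-homo-⁻¹ (inversions (b ∷ a ∷ ys))))
interchange-sign (_ ∷ uniq) (x ∷ xs , a , b , ys , refl , refl) = begin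
  sign (x ∷ v′)                          ≡⟨ sign-∷ x v′ ⟩
  parity (below x v′) ℙ.+ sign v′        ≡⟨ cong₂ (λ k p → parity k ℙ.+ p) (below-↭ x (interchange⇒↭ s))
                                                 (sym (interchange-sign uniq s)) ⟨
  parity (below x u′) ℙ.+ sign u′ ⁻¹     ≡⟨ +-⁻¹ (parity (below x u′)) _ ⟩
  (parity (below x u′) ℙ.+ sign u′) ⁻¹   ≡⟨ cong _⁻¹ (sign-∷ x u′) ⟨
  sign (x ∷ u′) ⁻¹                       ∎
  where
  open ≡-Reasoning
  u′ = xs ++ a ∷ b ∷ ys
  v′ = xs ++ b ∷ a ∷ ys
  s : AdjacentInterchange u′ v′
  s = xs , a , b , ys , refl , refl

walk-sign : Unique u → Walk u v ws → sign v ≡ parity (length ws) ℙ.+ sign u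
walk-sign _    ε                       = refl
walk-sign uniq (_◅_ {u} {ws = ws} s p) = begin
  _                                    ≡⟨ walk-sign (Unique-resp-↭ (interchange⇒↭ s) uniq) p ⟩
  parity (length ws) ℙ.+ _             ≡⟨ cong (parity (length ws) ℙ.+_) (interchange-sign uniq s) ⟩
  parity (length ws) ℙ.+ sign u ⁻¹     ≡⟨ +-⁻¹ (parity (length ws)) _ ⟩
  (parity (length ws) ℙ.+ sign u) ⁻¹   ≡⟨ ⁻¹-+ (parity (length ws)) _ ⟨
  parity (length ws) ⁻¹ ℙ.+ sign u     ≡⟨ cong (ℙ._+ sign u) (parity-suc (length ws)) ⟨
  parity (suc (length ws)) ℙ.+ sign u  ∎
  where open ≡-Reasoning

-- This is n(n-1)/2, the number of pairs of positions.
triangular : ℕ → ℕ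
triangular zero    = 0
triangular (suc n) = n + triangular n

-- The first letter is bubbled to the end, then the rest is reversed in front of it. The sign of a
-- reversal thereby becomes an instance of `walk-sign`.
reversal-walk : ∀ w → ∃ λ ws → Walk w (reverse w) ws × length ws ≡ triangular (length w)
reversal-walk []      = [] , ε , refl
reversal-walk (x ∷ w) with bubble w | reversal-walk w
  where
  bubble : ∀ w → ∃ λ ws → Walk (x ∷ w) (w ∷ʳ x) ws × length ws ≡ length w
  bubble []      = [] , ε , refl
  bubble (y ∷ w) with ws , p , eq ← bubble w =
    (x ∷ y ∷ w) ∷ map (y ∷_) ws , interchange-first ◅ walk-map (y ∷_) interchange-∷ p ,
    cong suc (≡-trans (length-map (y ∷_) ws) eq)
... | us , p , eq | vs , q , eq′ =
  us ++ map (_∷ʳ x) vs ,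
  subst (λ v → Walk (x ∷ w) v (us ++ map (_∷ʳ x) vs)) (sym (unfold-reverse x w))
        (p ◅◅ walk-map (_∷ʳ x) interchange-∷ʳ q) ,
  ≡-trans (length-++ us) (cong₂ _+_ eq (≡-trans (length-map (_∷ʳ x) vs) eq′))

reverse-sign : ∀ w → Unique w → sign (reverse w) ≡ parity (triangular (length w)) ℙ.+ sign w
reverse-sign w uniq with ws , p , eq ← reversal-walk w =
  subst (λ k → sign (reverse w) ≡ parity k ℙ.+ sign w) eq (walk-sign uniq p)

-- Regions

-- free A stands for the words on the letters A, and con A for the words on
-- the letters 1 , 2 , A in which 1 precedes 2.
data Region : Set where
  free con : Word → Region

Option : Set
Option = ℕ × Region

choices : Word → List (ℕ × Word)
choices []      = []
choices (x ∷ A) = (x , A) ∷ map (map₂ (x ∷_)) (choices A)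

-- The possible first letters, each with the region of the remaining word.
options : Region → List Option
options (free A) = map (map₂ free) (choices A)
options (con A)  = (1 , free (2 ∷ A)) ∷ map (map₂ con) (choices A)

letters : Region → Word
letters (free A) = A
letters (con A)  = 1 ∷ 2 ∷ A

-- Wrapped in a record so that the region can be inferred from the type; `letters R` alone does not
-- determine `R`.
record Valid (R : Region) : Set where
  constructor valid
  field distinct : Unique (letters R)

open Valid

-- The words of a region, that is, the linear extensions of an order in which at most 1 and 2 are
-- comparable.
data Lin : Region → Word → Set where
  []   : Lin (free []) []
  cons : ∀ {R S} → (c , S) ∈ options R → Lin S w → Lin R (c ∷ w)

variable
  R S T S₁ S₂ : Region

choices-letters : ∀ A → map proj₁ (choices A) ≡ A
choices-letters []      = refl
choices-letters (x ∷ A) = cong (x ∷_) (≡-trans (sym (map-∘ (choices A))) (choices-letters A))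

options-letters-free : ∀ A → map proj₁ (options (free A)) ≡ A
options-letters-free A = ≡-trans (sym (map-∘ (choices A))) (choices-letters A)

options-letters-con : ∀ A → map proj₁ (options (con A)) ≡ 1 ∷ A
options-letters-con A = cong (1 ∷_) (≡-trans (sym (map-∘ (choices A))) (choices-letters A))

choices-↭ : (c , B) ∈ choices A → A ↭ c ∷ B
choices-↭ {A = x ∷ A} (here refl) = refl
choices-↭ {A = x ∷ A} (there p) with (c , B) , q , refl ← ∈-map⁻ _ p =
  trans (prep x (choices-↭ q)) (swap x c refl)

∈-choices : c ∈ A → ∃ λ B → (c , B) ∈ choices A
∈-choices {c} {A} c∈A
  with (_ , B) , q , refl ← ∈-map⁻ proj₁ (subst (c ∈_) (sym (choices-letters A)) c∈A) = B , q

∈-free : (c , B) ∈ choices A → (c , free B) ∈ options (free A)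
∈-free = ∈-map⁺ (map₂ free)

∈-con : (c , B) ∈ choices A → (c , con B) ∈ options (con A)
∈-con p = there (∈-map⁺ (map₂ con) p)

choices-commute : c ≢ d → (c , A) ∈ choices w → (d , B) ∈ choices w →
                  ∃ λ C → (d , C) ∈ choices A × (c , C) ∈ choices B
choices-commute {w = x ∷ w} c≢d (here refl) (here refl) = contradiction refl c≢d
choices-commute {w = x ∷ w} c≢d (here refl) (there q) with (d , C) , q′ , refl ← ∈-map⁻ _ q = C , q′ , here refl
choices-commute {w = x ∷ w} c≢d (there p) (here refl) with (c , C) , p′ , refl ← ∈-map⁻ _ p = C , here refl , p′
choices-commute {w = x ∷ w} c≢d (there p) (there q)
  with (c , A) , p′ , refl ← ∈-map⁻ _ p | (d , B) , q′ , refl ← ∈-map⁻ _ q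
  with C , r , s ← choices-commute c≢d p′ q′ =
  x ∷ C , there (∈-map⁺ (map₂ (x ∷_)) r) , there (∈-map⁺ (map₂ (x ∷_)) s)

-- This makes interchanging the first two letters a step from one class to another. No word of
-- `con A` starts with 2, so 1 and 2 never meet here as the two first letters; after 1 is removed, 2
-- stays behind as a free letter in either order.
options-commute : c ≢ d → (c , S) ∈ options R → (d , T) ∈ options R →
                  ∃ λ C → (d , C) ∈ options S × (c , C) ∈ options T
options-commute {R = free w} c≢d p q
  with (c , A) , p′ , refl ← ∈-map⁻ _ p | (d , B) , q′ , refl ← ∈-map⁻ _ q
  with C , r , s ← choices-commute c≢d p′ q′ = free C , ∈-free r , ∈-free s
options-commute {R = con w} c≢d (here refl) (here refl) = contradiction refl c≢d
options-commute {R = con w} c≢d (here refl) (there q) with (d , B) , q′ , refl ← ∈-map⁻ _ q =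
  free (2 ∷ B) , there (∈-map⁺ (map₂ free) (∈-map⁺ (map₂ (2 ∷_)) q′)) , here refl
options-commute {R = con w} c≢d (there p) (here refl) with (c , B) , p′ , refl ← ∈-map⁻ _ p =
  free (2 ∷ B) , here refl , there (∈-map⁺ (map₂ free) (∈-map⁺ (map₂ (2 ∷_)) p′))
options-commute {R = con w} c≢d (there p) (there q)
  with (c , A) , p′ , refl ← ∈-map⁻ _ p | (d , B) , q′ , refl ← ∈-map⁻ _ q
  with C , r , s ← choices-commute c≢d p′ q′ = con C , ∈-con r , ∈-con s

options-↭ : ∀ R → (c , S) ∈ options R → letters R ↭ c ∷ letters S
options-↭ (free A) p with (c , B) , q , refl ← ∈-map⁻ _ p = choices-↭ q
options-↭ (con A) (here refl) = refl
options-↭ (con A) (there p) with (c , B) , q , refl ← ∈-map⁻ _ p =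
  trans (prep 1 (prep 2 (choices-↭ q))) (trans (prep 1 (swap 2 c refl)) (swap 1 c refl))

tail-unique : Unique (c ∷ w) → Unique w
tail-unique (_ ∷ uniq) = uniq

option-valid : Valid R → (c , S) ∈ options R → Valid S
option-valid {R} v p = valid (tail-unique (Unique-resp-↭ (options-↭ R p) (distinct v)))

options-unique : Valid R → Unique (map proj₁ (options R))
options-unique {free A} (valid uniq) = subst Unique (sym (options-letters-free A)) uniq
options-unique {con A} (valid ((_ ∷ 1#) ∷ _ ∷ uniq)) = subst Unique (sym (options-letters-con A)) (1# ∷ uniq)

option-functional : ∀ {os : List Option} → Unique (map proj₁ os) → (c , S) ∈ os → (c , T) ∈ os → S ≡ T
option-functional _        (here refl) (here refl) = refl
option-functional (# ∷ _)  (here refl) (there q)   = contradiction refl (lookup # (∈-map⁺ proj₁ q))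
option-functional (# ∷ _)  (there p)   (here refl) = contradiction refl (lookup # (∈-map⁺ proj₁ p))
option-functional (_ ∷ uq) (there p)   (there q)   = option-functional uq p q

lin-option : Valid R → (b , S) ∈ options R → Lin R (b ∷ v) → Lin S v
lin-option {v = v} vR p (cons q l) = subst (λ S → Lin S v) (option-functional (options-unique vR) q p) l

exchange : Valid R → c ≢ d → (c , S) ∈ options R → (d , T) ∈ options R → Lin S (d ∷ v) → Lin T (c ∷ v)
exchange {R} vR c≢d p q l with C , r , s ← options-commute {R = R} c≢d p q =
  cons s (lin-option (option-valid vR p) r l)

lin-↭ : Lin R w → w ↭ letters R
lin-↭ []         = refl
lin-↭ (cons {R = R} p l) = trans (prep _ (lin-↭ l)) (↭-sym (options-↭ R p))

lin-unique : Valid R → Lin R w → Unique w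
lin-unique (valid uniq) l = Unique-resp-↭ (↭-sym (lin-↭ l)) uniq

lin-free : w ↭ A → Lin (free A) w
lin-free {[]} p with refl ← ↭-empty-inv (↭-sym p) = []
lin-free {c ∷ w} p with B , q ← ∈-choices (∈-resp-↭ p (here refl)) =
  cons (∈-free q) (lin-free (drop-∷ (trans p (choices-↭ q))))

-- Together with `lin-con⁻` this describes the words of `con A` by the places of 1 and 2,
-- independently of the order in which `A` is listed.
lin-con : ∀ xs ys zs → xs ++ ys ++ zs ↭ A → Lin (con A) (xs ++ 1 ∷ ys ++ 2 ∷ zs)
lin-con [] ys zs p = cons (here refl) (lin-free (trans (shift 2 ys zs) (prep 2 p)))
lin-con (x ∷ xs) ys zs p with B , q ← ∈-choices (∈-resp-↭ p (here refl)) =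
  cons (∈-con q) (lin-con xs ys zs (drop-∷ (trans p (choices-↭ q))))

lin-con⁻ : Lin (con A) w → ∃₂ λ xs ys → ∃ λ zs → w ≡ xs ++ 1 ∷ ys ++ 2 ∷ zs × xs ++ ys ++ zs ↭ A
lin-con⁻ {A} (cons (here refl) l)
  with ys , zs , refl ← ∈-∃++ (∈-resp-↭ (↭-sym (lin-↭ l)) (here refl)) =
  [] , ys , zs , refl , drop-∷ (trans (↭-sym (shift 2 ys zs)) (lin-↭ l))
lin-con⁻ (cons (there p) l)
  with (x , B) , q , refl ← ∈-map⁻ _ p
  with xs , ys , zs , refl , r ← lin-con⁻ l =
  x ∷ xs , ys , zs , refl , trans (prep x r) (↭-sym (choices-↭ q))

lin-con-↭ : A ↭ B → Lin (con A) w → Lin (con B) w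
lin-con-↭ p l with xs , ys , zs , refl , q ← lin-con⁻ l = lin-con xs ys zs (trans q p)

-- This is (k+2)!/2. The recursion splits by first letter as `options` does: after 1 the other k+2
-- letters are free, after each of the k+1 remaining letters the constraint persists.
conCount : ℕ → ℕ
conCount zero    = 1
conCount (suc k) = suc (suc k) ! + suc k * conCount k

size : Region → ℕ
size (free A) = length A !
size (con A)  = conCount (length A)

total : List Option → ℕ
total os = sum (map (size ∘ proj₂) os)

choice-length : (c , B) ∈ choices A → suc (length B) ≡ length A
choice-length p = sym (↭-length (choices-↭ p))

sum-const : ∀ {X : Set} (f : X → ℕ) k (xs : List X) → (∀ {x} → x ∈ xs → f x ≡ k) →
            sum (map f xs) ≡ length xs * k
sum-const f k []       eq = refl
sum-const f k (x ∷ xs) eq = cong₂ _+_ (eq (here refl)) (sum-const f k xs (eq ∘ there))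

length-choices : ∀ A → length (choices A) ≡ length A
length-choices A = ≡-trans (sym (length-map proj₁ (choices A))) (cong length (choices-letters A))

total-choices : ∀ A (f : Word → Region) k → (∀ {B} → suc (length B) ≡ length A → size (f B) ≡ k) →
                total (map (map₂ f) (choices A)) ≡ length A * k
total-choices A f k eq = ≡-trans (sum-const (size ∘ proj₂) k _ each)
  (cong (_* k) (≡-trans (length-map (map₂ f) (choices A)) (length-choices A)))
  where
  each : ∀ {o} → o ∈ map (map₂ f) (choices A) → size (proj₂ o) ≡ k
  each p with _ , q , refl ← ∈-map⁻ _ p = eq (choice-length q)

-- The hypothesis excludes `free []`, which has one word but no options.
total-options : c ∈ letters R → total (options R) ≡ size R
total-options {R = free (x ∷ A)} _ = total-choices (x ∷ A) free (length A !) (cong _! ∘ suc-injective)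
total-options {R = con []}       _ = refl
total-options {R = con (x ∷ A)}  _ =
  cong (suc (suc (length A)) ! +_) (total-choices (x ∷ A) con (conCount (length A)) (cong conCount ∘ suc-injective))

conCount-double : ∀ k → conCount k + conCount k ≡ suc (suc k) !
conCount-double zero    = refl
conCount-double (suc k) = begin
  (f + j * m) + (f + j * m)   ≡⟨ solve 3 (λ f j m → (f :+ j :* m) :+ (f :+ j :* m) := (con₀ 2 :* f) :+ j :* (m :+ m)) refl f j m ⟩
  2 * f + j * (m + m)         ≡⟨ cong (λ x → 2 * f + j * x) (conCount-double k) ⟩
  2 * f + j * f               ≡⟨ solve 2 (λ f j → (con₀ 2 :* f) :+ j :* f := (con₀ 2 :+ j) :* f) refl f j ⟩
  (2 + j) * f                 ∎
  where
  open ≡-Reasoning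
  open import Data.Nat.Solver using (module +-*-Solver)
  open +-*-Solver using (solve; _:+_; _:*_; _:=_) renaming (con to con₀)
  f = suc (suc k) !
  j = suc k
  m = conCount k

-- Chaining the classes of a region

-- A Hamiltonian path: `complete` together with the exact `count` leaves no room for repetitions.
-- The `suc` accounts for the last word, which `words` omits.
record Tour (R : Region) (u v : Word) : Set where
  constructor tour
  field
    {words}  : List Word
    walk     : Walk u v words
    complete : ∀ {w} → Lin R w → w ∈ words ∷ʳ v
    count    : suc (length words) ≡ size R

-- Only the first letter of the end is prescribed. This is all that a step to the next class
-- requires, and it avoids any condition on signs.
Versatile : Region → Set
Versatile R = ∀ {a b S u} → Lin R (a ∷ u) → (b , S) ∈ options R → a ≢ b →
              ∃ λ v → Tour R (a ∷ u) (b ∷ v) × Lin R (b ∷ v)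

-- Hamiltonian laceability of the bipartite graph whose sides are the two signs, restricted to ends
-- with distinct first letters.
Laceable : Region → Set
Laceable R = ∀ {a b u v} → Lin R (a ∷ u) → Lin R (b ∷ v) → a ≢ b →
             sign (b ∷ v) ≡ sign (a ∷ u) ⁻¹ → Tour R (a ∷ u) (b ∷ v)

-- A walk through all words of the classes os that steps from there to a word
-- of the class o with second letter a.
record Passage (os : List Option) (u : Word) (o : Option) (a : ℕ) : Set where
  constructor passage
  field
    {rest}   : Word
    {words}  : List Word
    walk     : Walk u (proj₁ o ∷ a ∷ rest) words
    lin      : Lin (proj₂ o) (a ∷ rest)
    complete : (c , S) ∈ os → Lin S w → c ∷ w ∈ words
    count    : length words ≡ total os

variable
  o : Option
  os os′ : List Option

variable
  p q : Option

-- Inside the class of `c` one walks to a word `c b v`, from which `b c v` is one interchange away.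
-- Versatility can only reach `b` if the start has another second letter, hence `d ≢ proj₁ o`.
cross : Valid R → (c , S) ∈ options R → o ∈ options R → c ≢ proj₁ o → Versatile S →
        Lin S (d ∷ u) → d ≢ proj₁ o → Passage [ c , S ] (c ∷ d ∷ u) o c
cross {R} {c = c} {S = S} {o = b , T} vR p q c≢b vers l d≢b
  with C , r , s ← options-commute {R = R} c≢b p q
  with v , tour {ws} wk comp cnt , l′ ← vers l r d≢b =
  passage (walk-map (c ∷_) interchange-∷ wk ▻ interchange-first)
          (exchange vR c≢b p q l′)
          (λ { (here refl) m → subst (c ∷ _ ∈_) (map-++ (c ∷_) ws _) (∈-map⁺ (c ∷_) (comp m)) })
          (begin
            length (map (c ∷_) ws ∷ʳ (c ∷ b ∷ v))  ≡⟨ length-++ (map (c ∷_) ws) ⟩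
            length (map (c ∷_) ws) + 1             ≡⟨ +-comm _ 1 ⟩
            suc (length (map (c ∷_) ws))           ≡⟨ cong suc (length-map (c ∷_) ws) ⟩
            suc (length ws)                        ≡⟨ cnt ⟩
            size S                                 ≡⟨ +-comm 0 (size S) ⟩
            size S + 0                             ∎)
  where open ≡-Reasoning

join : Passage [ p ] u q a → (∀ {v} → Lin (proj₂ q) (a ∷ v) → Passage (q ∷ os) (proj₁ q ∷ a ∷ v) o b) →
       Passage (p ∷ q ∷ os) u o b
join (passage {_} {ws} wk l comp cnt) next with passage {_} {vs} wk′ l′ comp′ cnt′ ← next l =
  passage (wk ◅◅ wk′) l′
    (λ { (here refl) m → ∈-++⁺ˡ (comp (here refl) m) ; (there i) m → ∈-++⁺ʳ ws (comp′ i m) })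
    (≡-trans (length-++ ws) (cong₂ _+_ (≡-trans cnt (+-identityʳ _)) cnt′))

first : List Option → Option → ℕ
first []      o = proj₁ o
first (p ∷ _) _ = proj₁ p

-- The letter of the last class passed, which becomes the second letter of the word stepped to.
final : Option → List Option → ℕ
final p []       = proj₁ p
final _ (p ∷ os) = final p os

≢first : ∀ os → All (c ≢_) (map proj₁ os) → c ≢ proj₁ o → c ≢ first os o
≢first []       _         c≢o = c≢o
≢first (_ ∷ os) (c≢p ∷ _) _   = c≢p

-- Only the first crossing constrains the second letter `d`. Afterwards the second letter on arrival
-- is the letter of the class just left, and this differs from that of the next class because all
-- letters are distinct.
chain : Valid R → All (λ p → p ∈ options R × Versatile (proj₂ p)) ((c , S) ∷ os) → o ∈ options R →
        Unique (map proj₁ (o ∷ (c , S) ∷ os)) → Lin S (d ∷ u) → d ≢ first os o →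
        Passage ((c , S) ∷ os) (c ∷ d ∷ u) o (final (c , S) os)
chain {os = []} vR ((p , vers) ∷ []) q ((o≢c ∷ []) ∷ _) l d≢o = cross vR p q (o≢c ∘ sym) vers l d≢o
chain {os = _ ∷ os} vR ((m , vers) ∷ ms@((m′ , _) ∷ _)) q ((o≢c ∷ o#) ∷ ((c≢p ∷ c#) ∷ uniq)) l d≢p =
  join (cross vR m m′ c≢p vers l d≢p)
       (λ l′ → chain vR ms q (o# ∷ uniq) l′ (≢first os c# (o≢c ∘ sym)))

lin-cons : c ∈ letters R → Lin R w → ∃₂ λ d S → ∃ λ v → w ≡ d ∷ v × (d , S) ∈ options R × Lin S v
lin-cons () []
lin-cons _  (cons p l) = _ , _ , _ , refl , p , l

tour-from-passage : options R ↭ o ∷ os → c ∈ letters R → (P : Passage os u o a) →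
                    Tour (proj₂ o) (a ∷ Passage.rest P) v → Tour R u (proj₁ o ∷ v)
tour-from-passage {R} {o = b , S} {os} {v = v} eq c∈R
  (passage {_} {ws} wk l comp cnt) (tour {vs} wk′ comp′ cnt′) = record
  { walk     = wk ◅◅ walk-map (b ∷_) interchange-∷ wk′
  ; complete = complete
  ; count    = begin
      suc (length (ws ++ map (b ∷_) vs))          ≡⟨ cong suc (length-++ ws) ⟩
      suc (length ws + length (map (b ∷_) vs))    ≡⟨ +-suc (length ws) _ ⟨
      length ws + suc (length (map (b ∷_) vs))    ≡⟨ cong₂ (λ m n → m + suc n) cnt (length-map (b ∷_) vs) ⟩
      total os + suc (length vs)                  ≡⟨ cong (total os +_) cnt′ ⟩
      total os + size S                           ≡⟨ +-comm (total os) (size S) ⟩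
      total ((b , S) ∷ os)                        ≡⟨ sum-↭ (↭-map⁺ (size ∘ proj₂) eq) ⟨
      total (options R)                           ≡⟨ total-options {R = R} c∈R ⟩
      size R                                      ∎
  }
  where
  open ≡-Reasoning
  split : (ws ++ map (b ∷_) vs) ∷ʳ (b ∷ v) ≡ ws ++ map (b ∷_) (vs ∷ʳ v)
  split = ≡-trans (++-assoc ws _ _) (cong (ws ++_) (sym (map-++ (b ∷_) vs _)))
  locate : (d , T) ∈ (b , S) ∷ os → Lin T w → d ∷ w ∈ ws ++ map (b ∷_) (vs ∷ʳ v)
  locate (here refl) m = ∈-++⁺ʳ ws (∈-map⁺ (b ∷_) (comp′ m))
  locate (there i)   m = ∈-++⁺ˡ (comp i m)
  complete : ∀ {w} → Lin R w → w ∈ (ws ++ map (b ∷_) vs) ∷ʳ (b ∷ v)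
  complete {w} l with d , T , x , refl , p , m ← lin-cons c∈R l =
    subst (w ∈_) (sym split) (locate (∈-resp-↭ eq p) m)

-- Of two distinct letters, at least one differs from `d`.
pick : Unique (map proj₁ os) → 2 ≤ length os → ∀ d → ∃₂ λ o os′ → os ↭ o ∷ os′ × d ≢ proj₁ o
pick {_ ∷ []} _ (s≤s ()) d
pick {p ∷ q ∷ _} ((p≢q ∷ _) ∷ _) _ d with d ≟ proj₁ p
... | no  d≢p  = p , _ , refl , d≢p
... | yes refl = q , _ , swap p q refl , p≢q

extract : p ∈ os → q ∈ os → proj₁ p ≢ proj₁ q → ∃ λ os′ → os ↭ p ∷ q ∷ os′
extract (here refl) (here refl) p≢q = contradiction refl p≢q
extract {p} (here refl) (there j) _ with xs , ys , refl ← ∈-∃++ j = xs ++ ys , prep p (shift _ xs ys)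
extract {q = q} (there i) (here refl) _ with xs , ys , refl ← ∈-∃++ i =
  xs ++ ys , trans (prep q (shift _ xs ys)) (swap q _ refl)
extract (there {x} i) (there j) p≢q with os′ , r ← extract i j p≢q =
  x ∷ os′ , trans (prep x r) (trans (swap x _ refl) (prep _ (swap x _ refl)))

unique-letters-↭ : os ↭ os′ → Unique (map proj₁ os) → Unique (map proj₁ os′)
unique-letters-↭ r = Unique-resp-↭ (↭-map⁺ proj₁ r)

unique-options : Valid R → options R ↭ os → Unique (map proj₁ os)
unique-options vR r = unique-letters-↭ r (options-unique vR)

option-letter : ∀ R → (c , S) ∈ options R → c ∈ letters R
option-letter R p = ∈-resp-↭ (↭-sym (options-↭ R p)) (here refl)

final-all : ∀ {P : ℕ → Set} os → All P (map proj₁ (p ∷ os)) → P (final p os)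
final-all []       (x ∷ []) = x
final-all (_ ∷ os) (_ ∷ xs) = final-all os xs

final-∷ʳ : ∀ p os → final p (os ∷ʳ q) ≡ proj₁ q
final-∷ʳ p []       = refl
final-∷ʳ p (o ∷ os) = final-∷ʳ o os

reorder : ∀ {P : Option → Set} → options R ↭ os → All P (options R) → All (λ p → p ∈ options R × P p) os
reorder r ps = All-resp-↭ r (tabulate (λ i → i , lookup ps i))

-- The classes are visited in the order a, o, the others, b, where the letter of o differs from the
-- second letter of the start. Four options guarantee two candidates for o besides a and b.
versatile-step : Valid R → All (Versatile ∘ proj₂) (options R) → 4 ≤ length (options R) → Versatile R
versatile-step {R} vR vers n≥4 (cons {S = S} p l) q a≢b
  with rest , r ← extract p q a≢b
  -- The region `C` left by removing both letters shows that `S` is not empty, so the start has a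
  -- second letter, and that `T` admits `a` as first letter.
  with C , s , t ← options-commute {R = R} a≢b p q
  with _ , _ , _ , refl , _ ← lin-cons (option-letter S s) l
  with uniq@(_ ∷ _ ∷ uniq′) ← unique-options vR r
  with s≤s (s≤s n≥2) ← subst (4 ≤_) (↭-length r) n≥4
  with o , os , r′ , d≢o ← pick uniq′ n≥2 _
  with r″ ← trans r (trans (prep _ (prep _ r′)) (swap _ _ refl))
  with b# ∷ a# ∷ _ ← unique-options vR r″
  with (_ , versb) ∷ ms ← reorder {R = R} r″ vers
  with P ← chain vR ms q (unique-options vR r″) l d≢o
  -- At least one class lies between those of a and b, so the second letter on arrival is not `a`,
  -- and a word starting with b a can be the end.
  with v , T , l′ ← versb (Passage.lin P) t (final-all os a# ∘ sym)
  = _ , tour-from-passage r″ (option-letter R p) P T , cons q l′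

total-even : ∀ os → All (λ o → parity (size (proj₂ o)) ≡ 0ℙ) os → parity (total os) ≡ 0ℙ
total-even []       []         = refl
total-even (o ∷ os) (ev ∷ evs) =
  ≡-trans (ℙ.+-homo-+ (size (proj₂ o)) (total os)) (cong₂ ℙ._+_ ev (total-even os evs))

-- The common first letter contributes equally to both signs, since the tails have the same letters.
sign-tail : u ↭ v → sign (b ∷ v) ≡ sign (b ∷ u) ⁻¹ → sign v ≡ sign u ⁻¹
sign-tail {u} {v} {b} u↭v eq = ℙ.+-cancelˡ-≡ (parity (below b v)) _ _ (begin
  parity (below b v) ℙ.+ sign v        ≡⟨ sign-∷ b v ⟨
  sign (b ∷ v)                         ≡⟨ eq ⟩
  sign (b ∷ u) ⁻¹                      ≡⟨ cong _⁻¹ (sign-∷ b u) ⟩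
  (parity (below b u) ℙ.+ sign u) ⁻¹   ≡⟨ cong (λ k → (parity k ℙ.+ sign u) ⁻¹) (below-↭ b u↭v) ⟩
  (parity (below b v) ℙ.+ sign u) ⁻¹   ≡⟨ +-⁻¹ (parity (below b v)) (sign u) ⟨
  parity (below b v) ℙ.+ sign u ⁻¹     ∎)
  where open ≡-Reasoning

-- The classes are visited in the order a, o, the others, o′, b. The letter of o avoids the second
-- letter `c` of the start and that of o′ avoids the second letter `d` of the end; choosing both
-- takes three classes besides a and b.
lace : Valid R → All (λ o → Versatile (proj₂ o) × parity (size (proj₂ o)) ≡ 0ℙ) (options R) →
       5 ≤ length (options R) → (a , S) ∈ options R → (b , T) ∈ options R → a ≢ b → Laceable T →
       Lin S (c ∷ u) → Lin T (d ∷ v) → sign (b ∷ d ∷ v) ≡ sign (a ∷ c ∷ u) ⁻¹ → Tour R (a ∷ c ∷ u) (b ∷ d ∷ v)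
lace {R} {a = a} {b = b} vR good n≥5 p q a≢b laceable l m eq
  with rest , r ← extract p q a≢b
  with uniq@(_ ∷ _ ∷ uniq′) ← unique-options vR r
  with s≤s (s≤s n≥3) ← subst (5 ≤_) (↭-length r) n≥5
  with o , os , r₁ , c≢o ← pick uniq′ (≤-trans (n≤1+n 2) n≥3) _
  with _ ∷ uniq″ ← unique-letters-↭ r₁ uniq′
  with s≤s n≥2 ← subst (3 ≤_) (↭-length r₁) n≥3
  with o′ , os′ , r₂ , d≢o′ ← pick uniq″ n≥2 _
  -- Moving `o′` to the end of the list makes its letter the second letter on arrival in the class
  -- of b.
  with r₃ ← trans r (trans (prep _ (prep _ (trans r₁ (prep o (trans r₂ (∷↭∷ʳ o′ os′)))))) (swap _ _ refl))
  with _ ∷ ms ← reorder {R = R} r₃ good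
  with P ← chain vR (All.map (map₂ proj₁) ms) q (unique-options vR r₃) l c≢o
  = tour-from-passage r₃ (option-letter R p) P
      -- All classes passed have even size, so the word of arrival has the sign of the start,
      -- opposite to that of the end.
      (laceable (Passage.lin P) m (λ f≡d → d≢o′ (≡-trans (sym f≡d) (final-∷ʳ o os′)))
        (sign-tail {b = b} (trans (lin-↭ (Passage.lin P)) (↭-sym (lin-↭ m)))
          (≡-trans eq (cong _⁻¹ (sym (≡-trans (walk-sign {u = a ∷ _} (lin-unique vR (cons p l)) (Passage.walk P))
            (cong (ℙ._+ _) (≡-trans (cong parity (Passage.count P)) (total-even _ (All.map (proj₂ ∘ proj₂) ms))))))))))

-- Small regions

_≟ʷ_ : DecidableEquality Word
_≟ʷ_ = ≡-dec _≟_

open import Data.List.Membership.DecPropositional _≟ʷ_ using (_∈?_)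

rank : Region → ℕ
rank R = length (letters R)

-- The number is fuel for the recursion and is meant to be the rank of the region.
words : ℕ → Region → List Word
words zero    _ = [ [] ]
words (suc n) R = concatMap (λ (c , S) → map (c ∷_) (words n S)) (options R)

option-rank : ∀ R → (c , S) ∈ options R → rank R ≡ suc (rank S)
option-rank R p = ↭-length (options-↭ R p)

lin-words : Lin R w → w ∈ words (rank R) R
lin-words [] = here refl
lin-words (cons {c} {w} {R} {S} p l) = subst (λ n → c ∷ w ∈ words n R) (sym (option-rank R p))
  (∈-concatMap⁺ _ (Any.map (λ { refl → ∈-map⁺ (c ∷_) (lin-words l) }) p))

lin-words⁻ : ∀ n → rank R ≡ n → w ∈ words n R → Lin R w
lin-words⁻ {free []} zero _ (here refl) = []
lin-words⁻ {R} (suc n) eq i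
  with (c , S) , p , j ← find (∈-concatMap⁻ _ {xs = options R} i)
  with w , k , refl ← ∈-map⁻ (c ∷_) j =
  cons p (lin-words⁻ n (suc-injective (≡-trans (sym (option-rank R p)) eq)) k)

-- Positions are counted from 1, so that the decimal digits of a number can
-- list the successive interchanges of a walk.
swapAt : ℕ → Word → Word
swapAt 1             (a ∷ b ∷ w) = b ∷ a ∷ w
swapAt (suc (suc k)) (a ∷ w)     = a ∷ swapAt (suc k) w
swapAt _             w           = w

trace : List ℕ → Word → List Word
trace []       u = []
trace (k ∷ ks) u = u ∷ trace ks (swapAt k u)

end : List ℕ → Word → Word
end []       u = u
end (k ∷ ks) u = end ks (swapAt k u)

InRange : Word → ℕ → Set
InRange u k = 1 ≤ k × k < length u

length-swapAt : ∀ k u → length (swapAt k u) ≡ length u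
length-swapAt zero          u           = refl
length-swapAt 1             []          = refl
length-swapAt 1             (a ∷ [])    = refl
length-swapAt 1             (a ∷ b ∷ u) = refl
length-swapAt (suc (suc k)) []          = refl
length-swapAt (suc (suc k)) (a ∷ u)     = cong suc (length-swapAt (suc k) u)

swapAt-interchange : ∀ k u → InRange u k → AdjacentInterchange u (swapAt k u)
swapAt-interchange 1             (a ∷ [])    (_ , s≤s ())
swapAt-interchange 1             (a ∷ b ∷ u) _           = interchange-first
swapAt-interchange (suc (suc k)) (a ∷ u)     (_ , s≤s r) = interchange-∷ (swapAt-interchange (suc k) u (s≤s z≤n , r))

trace-walk : ∀ ks u → All (InRange u) ks → Walk u (end ks u) (trace ks u)
trace-walk []       u []       = ε
trace-walk (k ∷ ks) u (r ∷ rs) = swapAt-interchange k u r ◅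
  trace-walk ks (swapAt k u) (All.map (map₂ (subst (_ <_) (sym (length-swapAt k u)))) rs)

length-trace : ∀ ks u → length (trace ks u) ≡ length ks
length-trace []       u = refl
length-trace (k ∷ ks) u = cong suc (length-trace ks (swapAt k u))

-- The decidable counterpart of `Tour`, for a walk given by the positions of its interchanges.
record Traced (R : Region) (u : Word) (ks : List ℕ) : Set where
  constructor traced
  field
    in-range : All (InRange u) ks
    complete : All (_∈ trace ks u ∷ʳ end ks u) (words (rank R) R)
    count    : suc (length ks) ≡ size R

in-range? : ∀ u ks → Dec (All (InRange u) ks)
in-range? u = all? (λ k → (1 ≤? k) ×-dec (k <? length u))

traced? : ∀ R u ks → Dec (Traced R u ks)
traced? R u ks = map′ (λ (r , c , n) → traced r c n) (λ (traced r c n) → r , c , n)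
  (in-range? u ks ×-dec all? (_∈? (trace ks u ∷ʳ end ks u)) (words (rank R) R) ×-dec (suc (length ks) ≟ size R))

-- Renaming letters preserves walks, so one checked path serves all alphabets of the same length.
-- For alphabets listed explicitly, both equations hold by evaluation.
renamed-tour : ∀ f {ks} → words (rank S) S ≡ map (map f) (words (rank R) R) → size S ≡ size R →
               Traced R u ks → Tour S (map f u) (map f (end ks u))
renamed-tour {S} {R} {u} f {ks} words-eq size-eq (traced r comp cnt) = record
  { walk     = walk-map (map f) (interchange-map f) (trace-walk ks u r)
  ; complete = complete
  ; count    = begin
      suc (length (map (map f) (trace ks u)))   ≡⟨ cong suc (length-map (map f) (trace ks u)) ⟩
      suc (length (trace ks u))                 ≡⟨ cong suc (length-trace ks u) ⟩
      suc (length ks)                           ≡⟨ cnt ⟩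
      size R                                    ≡⟨ size-eq ⟨
      size S                                    ∎
  }
  where
  open ≡-Reasoning
  complete : Lin S w → w ∈ map (map f) (trace ks u) ∷ʳ map f (end ks u)
  complete {w} l with w₀ , i , refl ← ∈-map⁻ (map f) (subst (w ∈_) words-eq (lin-words l)) =
    subst (map f w₀ ∈_) (map-++ (map f) (trace ks u) _) (∈-map⁺ (map f) (lookup comp i))

-- Versatility at the single start `u`, in decidable form; the first alternative covers the letter
-- that `u` itself starts with.
Reaching : Region → Word × List ℕ → Set
Reaching R (u , ns) = All (λ b → head u ≡ just b ⊎
  Any (λ n → let ks = toNatDigits 10 n in
    head (end ks u) ≡ just b × end ks u ∈ words (rank R) R × Traced R u ks) ns) (map proj₁ (options R))

reaching? : ∀ R → Decidable (Reaching R)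
reaching? R (u , ns) = all? (λ b → Maybe.≡-dec _≟_ (head u) (just b) ⊎-dec
  any? (λ n → let ks = toNatDigits 10 n in
    Maybe.≡-dec _≟_ (head (end ks u)) (just b) ×-dec end ks u ∈? words (rank R) R ×-dec traced? R u ks) ns)
  (map proj₁ (options R))

-- Found by a computer search: three Hamiltonian paths for each starting word,
-- one towards each of the other possible first letters.
con-paths : List (Word × List ℕ)
con-paths =
  (1 ∷ 2 ∷ 3 ∷ 4 ∷ 5 ∷ [] ,
    34343241312313214121213142313243234123132313431321232123423 ∷
    34343214131212134323132141212321232321214313212143212323434 ∷
    34343214131212131413121213432121412123212323212123212323434 ∷ []) ∷
  (1 ∷ 3 ∷ 2 ∷ 4 ∷ 5 ∷ [] ,
    23434321312313214121213142313243234123132313431321232123423 ∷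
    14124343421413121213432121412123212323212141212143212323434 ∷
    14124343424131231321412121314212432341231321431321232123423 ∷ []) ∷
  (1 ∷ 3 ∷ 4 ∷ 2 ∷ 5 ∷ [] ,
    21214121213121214121213123214123232121432121232121434123213 ∷
    12121323214123432323132141212321232321214313212143212323434 ∷
    12121314124321412342413121214121213142124323231321232123423 ∷ []) ∷
  (1 ∷ 3 ∷ 4 ∷ 5 ∷ 2 ∷ [] ,
    12312121314124142131234343213123134241423132343134241213414 ∷
    12312121314124142131232141234321312341312121421323132414243 ∷
    12312121314124142141312141212131413143132412131412434342414 ∷ []) ∷
  (3 ∷ 1 ∷ 2 ∷ 4 ∷ 5 ∷ [] ,
    41423432143212141212341231321412323212123214121231343234323 ∷
    41234343231212134323132141212321232321214313212143212323434 ∷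
    41234343231212131413121213432121412123212323212123212323434 ∷ []) ∷
  (3 ∷ 1 ∷ 4 ∷ 2 ∷ 5 ∷ [] ,
    21234123432141341212341231321412323212123214121231343234323 ∷
    21231234343232313214121234231413121231341212131232121232343 ∷
    21234123434323231413121213432121412123212323212123212323434 ∷ []) ∷
  (3 ∷ 1 ∷ 4 ∷ 5 ∷ 2 ∷ [] ,
    12121312121314124142131242131242313241424312432323132123412 ∷
    12121312121314124142131232141234321312423132414243143212123 ∷
    12121312121314124142131232141234323234321212343214121231343 ∷ []) ∷
  (3 ∷ 4 ∷ 1 ∷ 2 ∷ 5 ∷ [] ,
    12341234214131212141212131412414214131212131212141232321412 ∷
    12121312324234321312313214121213121312123212313234123132134 ∷
    12341234343232131413123132141212131213121424321231323421231 ∷ []) ∷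
  (3 ∷ 4 ∷ 1 ∷ 5 ∷ 2 ∷ [] ,
    31212131412341423432143424121413142131413121424142313234323 ∷
    31212131412341234343232131413123413121214212131213121214123 ∷
    31212131412341234343232141213141214214131413141241421413141 ∷ []) ∷
  (3 ∷ 4 ∷ 5 ∷ 1 ∷ 2 ∷ [] ,
    12121314123412343421314131213124234323132414234324142431432 ∷
    12121314123412343432321314131231321412121312131214241421231 ∷
    12121314123412343432321314323132141232141231321431323231343 ∷ []) ∷
  []

-- For each word not starting with 3, a path from 3456 to it: a Hamiltonian one
-- if the word is odd, and otherwise a short one, which shows that it is even.
free-paths : List ℕ
free-paths =
  21213121213123212123213 ∷
  13 ∷
  12 ∷
  12132123232123132321232 ∷
  12121312131212132313212 ∷
  1232 ∷
  21 ∷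
  12121321232321212321232 ∷
  12321232321212323132323 ∷
  1213 ∷
  2132 ∷
  12121312132323132123212 ∷
  12121312121321232121232 ∷
  2321 ∷
  1321 ∷
  12121312131212321231323 ∷
  12121312321232123132323 ∷
  121321 ∷
  []

con₅ : Region
con₅ = con (3 ∷ 4 ∷ 5 ∷ [])

abstract
  con-reaching : All (Reaching con₅) con-paths
  con-reaching = from-yes (all? (reaching? con₅) con-paths)

nth : ∀ {X : Set} → X → List X → ℕ → X
nth z []       _       = z
nth z (x ∷ xs) zero    = x
nth z (x ∷ xs) (suc i) = nth z xs i

-- The tabulated paths use the letters 3 , 4 , 5 , …; renaming these to the
-- letters of A carries the paths over to any alphabet.
rename : Word → ℕ → ℕ
rename A (suc (suc (suc k))) = nth 0 A k
rename A k                   = k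

-- Used to pass between regions that list the same letters in different orders.
tour-transfer : (∀ {w} → Lin S w → Lin R w) → size R ≡ size S → Tour R u v → Tour S u v
tour-transfer f eq (tour wk comp cnt) = tour wk (comp ∘ f) (≡-trans cnt eq)

reaching-tour : ∀ f {ns} → words (rank S) S ≡ map (map f) (words (rank R) R) → size S ≡ size R →
                Reaching R (u , ns) → map f u ≡ a ∷ w → ∀ {b} → b ∈ map proj₁ (options R) → a ≢ f b →
                ∃ λ v → Tour S (a ∷ w) (f b ∷ v) × Lin S (f b ∷ v)
reaching-tour {S} {R} {u} f words-eq size-eq reach eq {b} b∈R a≢b with lookup reach b∈R
reaching-tour {u = []}    f _ _ _ ()   b∈R a≢b | inj₁ _
reaching-tour {u = _ ∷ _} f _ _ _ refl b∈R a≢b | inj₁ refl = contradiction refl a≢b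
reaching-tour {S} {R} {u} f words-eq size-eq reach eq b∈R a≢b | inj₂ i
  with n , _ , h , m , t ← find i
  with T ← renamed-tour {S} {R} f words-eq size-eq t
  with l ← lin-words⁻ {S} (rank S) refl (subst (_ ∈_) (sym words-eq) (∈-map⁺ (map f) m))
  with end (toNatDigits 10 n) u | h
... | b ∷ v | refl = map f v , subst (λ w → Tour S w (f b ∷ map f v)) eq T , l

insert-2 : Word → List Word
insert-2 []      = [ 2 ∷ [] ]
insert-2 (x ∷ w) = (2 ∷ x ∷ w) ∷ map (x ∷_) (insert-2 w)

-- The order matters: for the word 345 it is that of the starting words in `con-paths`.
insert-1-2 : Word → List Word
insert-1-2 []      = [ 1 ∷ 2 ∷ [] ]
insert-1-2 (x ∷ w) = map (1 ∷_) (insert-2 (x ∷ w)) ++ map (x ∷_) (insert-1-2 w)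

∈-insert-2 : ∀ ys zs → ys ++ 2 ∷ zs ∈ insert-2 (ys ++ zs)
∈-insert-2 []       []      = here refl
∈-insert-2 []       (_ ∷ _) = here refl
∈-insert-2 (y ∷ ys) zs      = there (∈-map⁺ (y ∷_) (∈-insert-2 ys zs))

∈-insert-1-2 : ∀ xs ys zs → xs ++ 1 ∷ ys ++ 2 ∷ zs ∈ insert-1-2 (xs ++ ys ++ zs)
∈-insert-1-2 []       []       []       = here refl
∈-insert-1-2 []       []       (z ∷ zs) = ∈-++⁺ˡ (∈-map⁺ (1 ∷_) (∈-insert-2 [] (z ∷ zs)))
∈-insert-1-2 []       (y ∷ ys) zs       = ∈-++⁺ˡ (∈-map⁺ (1 ∷_) (∈-insert-2 (y ∷ ys) zs))
∈-insert-1-2 (x ∷ xs) ys       zs       = ∈-++⁺ʳ (map (1 ∷_) (insert-2 (x ∷ _))) (∈-map⁺ (x ∷_) (∈-insert-1-2 xs ys zs))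

-- The letters other than 1 and 2 are renamed to 3, 4, 5 in the order in which they occur in the
-- start. This leaves ten starts, one for each choice of the places of 1 and 2.
con-base : length A ≡ 3 → Versatile (con A)
con-base {A} three {b = b} l q a≢b with xs , ys , zs , eq , r ← lin-con⁻ l =
  base (xs ++ ys ++ zs) (≡-trans (↭-length r) three) r
       (subst (_∈ insert-1-2 (xs ++ ys ++ zs)) (sym eq) (∈-insert-1-2 xs ys zs))
  where
  base : ∀ B → length B ≡ 3 → B ↭ A → _ ∷ _ ∈ insert-1-2 B → _
  base B@(_ ∷ _ ∷ _ ∷ []) refl r i
    -- By evaluation, `insert-1-2 B` is the renamed list of the starting words in `con-paths`.
    with u₀ , j , eq ← ∈-map⁻ (map (rename B)) {xs = insert-1-2 (3 ∷ 4 ∷ 5 ∷ [])} i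
    with row , k , refl ← ∈-map⁻ proj₁ {xs = con-paths} j
    with b₀ , m , refl ← ∈-map⁻ (rename B) {xs = 1 ∷ 3 ∷ 4 ∷ 5 ∷ []}
      (∈-resp-↭ (prep 1 (↭-sym r)) (subst (b ∈_) (options-letters-con A) (∈-map⁺ proj₁ q)))
    with v , T , l′ ← reaching-tour {con B} {con₅} (rename B) refl refl (lookup con-reaching k) (sym eq) m a≢b
    = v , tour-transfer (lin-con-↭ (↭-sym r)) (cong conCount (↭-length r)) T , lin-con-↭ r l′

free₄ : Region
free₄ = free (3 ∷ 4 ∷ 5 ∷ 6 ∷ [])

abstract
  free-reaching : Reaching free₄ (3 ∷ 4 ∷ 5 ∷ 6 ∷ [] , free-paths)
  free-reaching = from-yes (reaching? free₄ (3 ∷ 4 ∷ 5 ∷ 6 ∷ [] , free-paths))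

-- Evenness is witnessed by a walk and not by the sign itself, because a renaming carries walks over
-- but need not preserve signs.
Reached : Word → Set
Reached v = head v ≡ just 3 ⊎
  Any (λ n → let ks = toNatDigits 10 n; u = 3 ∷ 4 ∷ 5 ∷ 6 ∷ [] in
    end ks u ≡ v × (Traced free₄ u ks ⊎ (All (InRange u) ks × parity (length ks) ≡ 0ℙ))) free-paths

reached? : Decidable Reached
reached? v = Maybe.≡-dec _≟_ (head v) (just 3) ⊎-dec
  any? (λ n → let ks = toNatDigits 10 n; u = 3 ∷ 4 ∷ 5 ∷ 6 ∷ [] in
    end ks u ≟ʷ v ×-dec (traced? free₄ u ks ⊎-dec (in-range? u ks ×-dec parity (length ks) ℙ.≟ 0ℙ))) free-paths

abstract
  free-reached : All Reached (words 4 free₄)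
  free-reached = from-yes (all? reached? (words 4 free₄))

free-↭ : A ↭ B → Lin (free A) w → Lin (free B) w
free-↭ r l = lin-free (trans (lin-↭ l) r)

-- The start itself is taken as the alphabet, so that up to renaming it is always 3456.
free-base-versatile : length A ≡ 4 → Versatile (free A)
free-base-versatile {A} four {b = b} {u = u} l q a≢b = base u (≡-trans (↭-length (lin-↭ l)) four) (lin-↭ l) a≢b
  where
  base : ∀ {a} u → suc (length u) ≡ 4 → a ∷ u ↭ A → a ≢ b → ∃ λ v → Tour (free A) (a ∷ u) (b ∷ v) × Lin (free A) (b ∷ v)
  base {a} u@(_ ∷ _ ∷ _ ∷ []) refl r a≢b
    with b₀ , m , refl ← ∈-map⁻ (rename (a ∷ u)) {xs = 3 ∷ 4 ∷ 5 ∷ 6 ∷ []}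
      (∈-resp-↭ (↭-sym r) (subst (b ∈_) (options-letters-free A) (∈-map⁺ proj₁ q)))
    with v , T , l′ ← reaching-tour {free (a ∷ u)} {free₄} (rename (a ∷ u)) refl refl free-reaching refl m a≢b
    = v , tour-transfer (free-↭ (↭-sym r)) (cong _! (↭-length r)) T , free-↭ r l′

reached-tour : ∀ f {v} → Unique (map f (3 ∷ 4 ∷ 5 ∷ 6 ∷ [])) → Reached v → head v ≢ just 3 →
               sign (map f v) ≡ sign (map f (3 ∷ 4 ∷ 5 ∷ 6 ∷ [])) ⁻¹ →
               Tour (free (map f (3 ∷ 4 ∷ 5 ∷ 6 ∷ []))) (map f (3 ∷ 4 ∷ 5 ∷ 6 ∷ [])) (map f v)
reached-tour f _    (inj₁ eq) neq _ = contradiction eq neq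
reached-tour f uniq (inj₂ i)  _   opposite with find i
... | n , _ , refl , inj₁ t           = renamed-tour {R = free₄} f refl refl t
-- A walk of even length would give both ends the same sign, against `opposite`.
... | n , _ , refl , inj₂ (rs , even) =
  contradiction (≡-trans (sym same) opposite) (ℙ.p≢p⁻¹ (sign (map f start)))
  where
  open ≡-Reasoning
  start = 3 ∷ 4 ∷ 5 ∷ 6 ∷ []
  ks = toNatDigits 10 n
  steps = map (map f) (trace ks start)
  same : sign (map f (end ks start)) ≡ sign (map f start)
  same = begin
    sign (map f (end ks start))                     ≡⟨ walk-sign uniq (walk-map (map f) (interchange-map f)
                                                         (trace-walk ks start rs)) ⟩
    parity (length steps) ℙ.+ sign (map f start)    ≡⟨ cong (λ k → parity k ℙ.+ sign (map f start))
                                                         (≡-trans (length-map (map f) (trace ks start))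
                                                                  (length-trace ks start)) ⟩
    parity (length ks) ℙ.+ sign (map f start)       ≡⟨ cong (ℙ._+ sign (map f start)) even ⟩
    sign (map f start)                              ∎

free-base-laceable : length A ≡ 4 → Unique A → Laceable (free A)
free-base-laceable {A} four uniq {u = u} l m a≢b opposite =
  base u (≡-trans (↭-length (lin-↭ l)) four) (lin-↭ l) m a≢b opposite
  where
  base : ∀ {a b v} u → suc (length u) ≡ 4 → a ∷ u ↭ A → Lin (free A) (b ∷ v) → a ≢ b →
         sign (b ∷ v) ≡ sign (a ∷ u) ⁻¹ → Tour (free A) (a ∷ u) (b ∷ v)
  base {a} u@(_ ∷ _ ∷ _ ∷ []) refl r m a≢b opposite
    with x ∷ v₀ , i , refl ← ∈-map⁻ (map (rename (a ∷ u))) {xs = words 4 free₄} (lin-words (free-↭ (↭-sym r) m))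
    = tour-transfer (free-↭ (↭-sym r)) (cong _! (↭-length r))
        (reached-tour (rename (a ∷ u)) (Unique-resp-↭ (↭-sym r) uniq) (lookup free-reached i)
          (λ { refl → a≢b refl }) opposite)

-- Regions of arbitrary size

even-product : ∀ n → parity (suc n * n) ≡ 0ℙ
even-product n = begin
  parity (suc n * n)                ≡⟨ ℙ.*-homo-* (suc n) n ⟩
  parity (suc n) ℙ.* parity n       ≡⟨ cong (ℙ._* parity n) (parity-suc n) ⟩
  parity n ⁻¹ ℙ.* parity n          ≡⟨ ℙ.p⁻¹*p≡0ℙ (parity n) ⟩
  0ℙ                                ∎
  where open ≡-Reasoning

even-! : ∀ n → parity (suc (suc n) !) ≡ 0ℙ
even-! n = begin
  parity ((2 + n) * ((1 + n) * n !))                  ≡⟨ cong parity (*-assoc (2 + n) (1 + n) (n !)) ⟨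
  parity ((2 + n) * (1 + n) * n !)                    ≡⟨ ℙ.*-homo-* ((2 + n) * (1 + n)) (n !) ⟩
  parity ((2 + n) * (1 + n)) ℙ.* parity (n !)         ≡⟨ cong (ℙ._* parity (n !)) (even-product (1 + n)) ⟩
  0ℙ                                                  ∎
  where open ≡-Reasoning

-- Unfolding the recursion twice leaves even factorials and a multiple of the product (k+2)(k+1) of
-- consecutive numbers.
even-conCount : ∀ k → parity (conCount (suc (suc k))) ≡ 0ℙ
even-conCount k = begin
  parity ((3 + k) ! + (2 + k) * ((2 + k) ! + (1 + k) * m))
    ≡⟨ ℙ.+-homo-+ ((3 + k) !) _ ⟩
  parity ((3 + k) !) ℙ.+ parity ((2 + k) * ((2 + k) ! + (1 + k) * m))
    ≡⟨ cong₂ ℙ._+_ (even-! (1 + k)) (cong parity (*-distribˡ-+ (2 + k) ((2 + k) !) _)) ⟩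
  parity ((2 + k) * (2 + k) ! + (2 + k) * ((1 + k) * m))
    ≡⟨ ℙ.+-homo-+ ((2 + k) * (2 + k) !) _ ⟩
  parity ((2 + k) * (2 + k) !) ℙ.+ parity ((2 + k) * ((1 + k) * m))
    ≡⟨ cong₂ ℙ._+_ (even-*ʳ (2 + k) {(2 + k) !} (even-! k))
        (≡-trans (cong parity (sym (*-assoc (2 + k) (1 + k) m)))
          (≡-trans (cong parity (*-comm ((2 + k) * (1 + k)) m)) (even-*ʳ m {(2 + k) * (1 + k)} (even-product (1 + k))))) ⟩
  0ℙ ∎
  where
  open ≡-Reasoning
  m = conCount k
  even-*ʳ : ∀ i {n} → parity n ≡ 0ℙ → parity (i * n) ≡ 0ℙ
  even-*ʳ i {n} even = ≡-trans (ℙ.*-homo-* i n) (≡-trans (cong (parity i ℙ.*_) even) (ℙ.*-zeroʳ (parity i)))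

even-free : 2 ≤ length A → parity (size (free A)) ≡ 0ℙ
even-free {_ ∷ []}    (s≤s ())
even-free {_ ∷ _ ∷ A} _ = even-! (length A)

even-con : 2 ≤ length A → parity (size (con A)) ≡ 0ℙ
even-con {_ ∷ []}    (s≤s ())
even-con {_ ∷ _ ∷ A} _ = even-conCount (length A)

length-options-free : ∀ A → length (options (free A)) ≡ length A
length-options-free A = ≡-trans (length-map _ (choices A)) (length-choices A)

length-options-con : ∀ A → length (options (con A)) ≡ suc (length A)
length-options-con A = cong suc (≡-trans (length-map _ (choices A)) (length-choices A))

-- Both properties are proved together because the step for laceability uses the versatility of the
-- classes passed on the way and the laceability of the last one.
free-good : ∀ n A → length A ≡ 4 + n → Unique A → Versatile (free A) × Laceable (free A)
free-good zero A eq uniq = free-base-versatile eq , free-base-laceable eq uniq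
free-good (suc n) A eq uniq =
  versatile-step vA (tabulate (proj₁ ∘ good)) n≥4 , laceable
  where
  vA : Valid (free A)
  vA = valid uniq
  n≥5 : 5 ≤ length (options (free A))
  n≥5 = ≤-trans (m≤m+n 5 n) (≤-reflexive (sym (≡-trans (length-options-free A) eq)))
  n≥4 : 4 ≤ length (options (free A))
  n≥4 = ≤-trans (n≤1+n 4) n≥5
  good : ∀ {o} → o ∈ options (free A) →
         Versatile (proj₂ o) × Laceable (proj₂ o) × parity (size (proj₂ o)) ≡ 0ℙ
  good p with (c , B) , q , refl ← ∈-map⁻ _ p
    with eq′ ← suc-injective (≡-trans (choice-length q) eq)
    with vers , lac ← free-good n B eq′ (distinct (option-valid vA p)) =
    vers , lac , even-free {B} (≤-trans (m≤m+n 2 (2 + n)) (≤-reflexive (sym eq′)))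
  laceable : Laceable (free A)
  laceable (cons {S = S} p l) (cons {S = T} q m) a≢b
    with _ , r , r′ ← options-commute {R = free A} a≢b p q
    with _ , _ , _ , refl , _ ← lin-cons (option-letter S r) l
    with _ , _ , _ , refl , _ ← lin-cons (option-letter T r′) m =
    lace vA (tabulate (map₂ proj₂ ∘ good)) n≥5 p q a≢b (proj₁ (proj₂ (good q))) l m

con-versatile : ∀ n A → length A ≡ 3 + n → Valid (con A) → Versatile (con A)
con-versatile zero    A eq vA = con-base eq
con-versatile (suc n) A eq vA = versatile-step vA (tabulate good)
  (≤-trans (m≤m+n 4 (suc n)) (≤-reflexive (sym (≡-trans (length-options-con A) (cong suc eq)))))
  where
  good : ∀ {o} → o ∈ options (con A) → Versatile (proj₂ o)
  good (here refl) = proj₁ (free-good (suc n) (2 ∷ A) (cong suc eq) (distinct (option-valid vA (here refl))))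
  good (there p) with (c , B) , q , refl ← ∈-map⁻ _ p =
    con-versatile n B (suc-injective (≡-trans (choice-length q) eq)) (option-valid vA (there p))

-- From tours to Gray codes

words-unique : ∀ n → Valid R → Unique (words n R)
words-unique zero        _  = [] ∷ []
words-unique {R} (suc n) vR = go (options R) (options-unique vR) (option-valid vR)
  where
  extend : Option → List Word
  extend (c , S) = map (c ∷_) (words n S)
  first-letter : ∀ os → w ∈ concatMap extend os → ∃₂ λ c v → w ≡ c ∷ v × c ∈ map proj₁ os
  first-letter os i with (c , S) , p , j ← find (∈-concatMap⁻ extend {xs = os} i)
    with v , _ , eq ← ∈-map⁻ (c ∷_) j = c , v , eq , ∈-map⁺ proj₁ p
  go : ∀ os → Unique (map proj₁ os) → (∀ {c S} → (c , S) ∈ os → Valid S) → Unique (concatMap extend os)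
  go []             _           _  = []
  go ((c , S) ∷ os) (c# ∷ uniq) vs =
    Unique.++⁺ (Unique.map⁺ ∷-injectiveʳ (words-unique n (vs (here refl)))) (go os uniq (vs ∘ there)) disjoint
    where
    disjoint : w ∈ map (c ∷_) (words n S) × w ∈ concatMap extend os → ⊥
    disjoint (i , j) with _ , _ , refl ← ∈-map⁻ (c ∷_) i | _ , _ , refl , k ← first-letter os j =
      lookup c# k refl

words-length : ∀ n R → rank R ≡ n → length (words n R) ≡ size R
words-length zero    (free []) _  = refl
words-length (suc n) R         eq = ≡-trans (go (options R) ranks) (total-options {R = R} (proj₂ (letter (letters R) eq)))
  where
  letter : ∀ A → length A ≡ suc n → ∃ λ c → c ∈ A
  letter (c ∷ _) _ = c , here refl
  ranks : ∀ {c S} → (c , S) ∈ options R → rank S ≡ n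
  ranks p = suc-injective (≡-trans (sym (option-rank R p)) eq)
  go : ∀ os → (∀ {c S} → (c , S) ∈ os → rank S ≡ n) →
       length (concatMap (λ (c , S) → map (c ∷_) (words n S)) os) ≡ total os
  go []             _  = refl
  go ((c , S) ∷ os) rs = ≡-trans (length-++ (map (c ∷_) (words n S)))
    (cong₂ _+_ (≡-trans (length-map (c ∷_) (words n S)) (words-length n S (rs (here refl)))) (go os (rs ∘ there)))

-- A pigeonhole argument, removing one common entry at a time. It turns completeness and the right
-- length into the absence of repetitions.
unique-cover : ∀ {X : Set} {xs ys : List X} → Unique ys → (∀ {y} → y ∈ ys → y ∈ xs) →
               length xs ≡ length ys → ys ↭ xs
unique-cover {xs = []} {[]} _ _ _ = refl
unique-cover {ys = y ∷ ys} (y# ∷ uniq) sub eq with as , bs , refl ← ∈-∃++ (sub (here refl)) =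
  trans (prep y (unique-cover uniq sub′ eq′)) (↭-sym (shift y as bs))
  where
  eq′ : length (as ++ bs) ≡ length ys
  eq′ = suc-injective (≡-trans (sym (↭-length (shift y as bs))) eq)
  sub′ : ∀ {z} → z ∈ ys → z ∈ as ++ bs
  sub′ i with ∈-resp-↭ (shift y as bs) (sub (there i))
  ... | here refl = contradiction refl (lookup y# i)
  ... | there j   = j

nth-++ˡ : ∀ {X : Set} {z : X} xs {ys i} → i < length xs → nth z (xs ++ ys) i ≡ nth z xs i
nth-++ˡ (x ∷ xs) {i = zero}  _       = refl
nth-++ˡ (x ∷ xs) {i = suc i} (s≤s p) = nth-++ˡ xs p

nth-++ʳ : ∀ {X : Set} {z : X} xs {ys} i → nth z (xs ++ ys) (i + length xs) ≡ nth z ys i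
nth-++ʳ {z = z} []       {ys} i = cong (nth z ys) (+-identityʳ i)
nth-++ʳ {z = z} (x ∷ xs) {ys} i =
  ≡-trans (cong (nth z (x ∷ xs ++ ys)) (+-suc i (length xs))) (nth-++ʳ xs i)

nth-map : ∀ {X Y : Set} {y : Y} {z : X} (f : X → Y) xs {i} → i < length xs → nth y (map f xs) i ≡ f (nth z xs i)
nth-map f (x ∷ xs) {zero}  _       = refl
nth-map f (x ∷ xs) {suc i} (s≤s p) = nth-map f xs p

nth-∈ : ∀ {X : Set} {z : X} xs {i} → i < length xs → nth z xs i ∈ xs
nth-∈ (x ∷ xs) {zero}  _       = here refl
nth-∈ (x ∷ xs) {suc i} (s≤s p) = there (nth-∈ xs p)

∈-nth : ∀ {X : Set} {x z : X} {xs} → x ∈ xs → ∃ λ i → i < length xs × nth z xs i ≡ x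
∈-nth (here refl) = 0 , s≤s z≤n , refl
∈-nth (there p) with i , q , eq ← ∈-nth p = suc i , s≤s q , eq

nth-injective : ∀ {X : Set} {z : X} {xs} → Unique xs → ∀ {i j} → i < length xs → j < length xs →
                nth z xs i ≡ nth z xs j → i ≡ j
nth-injective {xs = _ ∷ xs} _         {zero}  {zero}  _       _       _  = refl
nth-injective {xs = _ ∷ xs} (x# ∷ _)  {zero}  {suc j} _       (s≤s q) eq = contradiction eq (lookup x# (nth-∈ xs q))
nth-injective {xs = _ ∷ xs} (x# ∷ _)  {suc i} {zero}  (s≤s p) _       eq = contradiction (sym eq) (lookup x# (nth-∈ xs p))
nth-injective {xs = _ ∷ xs} (_ ∷ uq)  {suc i} {suc j} (s≤s p) (s≤s q) eq = cong suc (nth-injective uq p q eq)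

walk-↭ : Walk u v ws → All (u ↭_) (ws ∷ʳ v)
walk-↭ ε       = refl ∷ []
walk-↭ (s ◅ p) = refl ∷ All.map (trans (interchange⇒↭ s)) (walk-↭ p)

walk-nth : Walk u v ws → ∀ {i} → i < length ws →
           AdjacentInterchange (nth [] (ws ∷ʳ v) i) (nth [] (ws ∷ʳ v) (suc i))
walk-nth (s ◅ ε)       {zero}  _       = s
walk-nth (s ◅ (_ ◅ _)) {zero}  _       = s
walk-nth (s ◅ p)       {suc i} (s≤s q) = walk-nth p q

-- If 2 comes first, reversal exchanges the order of 1 and 2. Thus the tour and its reversal
-- together cover all permutations.
one-before-two : w ↭ 1 ∷ 2 ∷ A → Lin (con A) w ⊎ Lin (con A) (reverse w)
one-before-two {A = A} p with xs , ys , refl ← ∈-∃++ (∈-resp-↭ (↭-sym p) (here refl))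
  with q ← drop-∷ (trans (↭-sym (shift 1 xs ys)) p)
  with ∈-++⁻ xs (∈-resp-↭ (↭-sym q) (here refl))
... | inj₂ i with ys₁ , ys₂ , refl ← ∈-∃++ i =
  inj₁ (lin-con xs ys₁ ys₂ (drop-∷ (trans (↭-sym moved) q)))
  where
  moved : xs ++ ys₁ ++ 2 ∷ ys₂ ↭ 2 ∷ xs ++ ys₁ ++ ys₂
  moved = trans (++⁺ˡ xs (shift 2 ys₁ ys₂)) (shift 2 xs (ys₁ ++ ys₂))
... | inj₁ i with xs₁ , xs₂ , refl ← ∈-∃++ i =
  inj₂ (subst (Lin (con A)) (sym reversed)
    (lin-con (reverse ys) (reverse xs₂) (reverse xs₁) (drop-∷ (trans (↭-sym moved) q))))
  where
  reversed : reverse ((xs₁ ++ 2 ∷ xs₂) ++ 1 ∷ ys) ≡ reverse ys ++ 1 ∷ reverse xs₂ ++ 2 ∷ reverse xs₁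
  reversed = begin
    reverse ((xs₁ ++ 2 ∷ xs₂) ++ 1 ∷ ys)                         ≡⟨ reverse-++ (xs₁ ++ 2 ∷ xs₂) (1 ∷ ys) ⟩
    reverse (1 ∷ ys) ++ reverse (xs₁ ++ 2 ∷ xs₂)                 ≡⟨ cong₂ _++_ (unfold-reverse 1 ys)
                                                                      (reverse-++ xs₁ (2 ∷ xs₂)) ⟩
    (reverse ys ∷ʳ 1) ++ reverse (2 ∷ xs₂) ++ reverse xs₁        ≡⟨ ++-assoc (reverse ys) _ _ ⟩
    reverse ys ++ 1 ∷ reverse (2 ∷ xs₂) ++ reverse xs₁           ≡⟨ cong (λ zs → reverse ys ++ 1 ∷ zs ++ reverse xs₁)
                                                                      (unfold-reverse 2 xs₂) ⟩
    reverse ys ++ 1 ∷ (reverse xs₂ ∷ʳ 2) ++ reverse xs₁          ≡⟨ cong (λ zs → reverse ys ++ 1 ∷ zs)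
                                                                      (++-assoc (reverse xs₂) _ _) ⟩
    reverse ys ++ 1 ∷ reverse xs₂ ++ 2 ∷ reverse xs₁             ∎
    where open ≡-Reasoning
  moved : (xs₁ ++ 2 ∷ xs₂) ++ ys ↭ 2 ∷ reverse ys ++ reverse xs₂ ++ reverse xs₁
  moved = trans (++⁺ʳ ys (shift 2 xs₁ xs₂)) (prep 2 (trans (++-comm (xs₁ ++ xs₂) ys)
    (++⁺ (↭-sym (↭-reverse ys)) (trans (++-comm xs₁ xs₂) (++⁺ (↭-sym (↭-reverse xs₂)) (↭-sym (↭-reverse xs₁)))))))

-- In this form `1 ∷ 2 ∷ letters-from-3 k` is `applyUpTo suc (2 + k)` by evaluation.
letters-from-3 : ℕ → Word
letters-from-3 k = applyUpTo (λ i → 3 + i) k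

gray-code : ∀ k → Tour (con (letters-from-3 k)) (reverse (letters-from-3 k) ++ 1 ∷ 2 ∷ []) (1 ∷ 2 ∷ letters-from-3 k) →
            ∃[ π ] IsReverseGrayCode (2 + k) π
gray-code k (tour {ws} walk complete count) = π , record
  { permutation = λ i → trans (↭-sym (lookup permutations (nth-∈ listing (bound i)))) start-↭
  ; injective   = λ {i} {j} eq → toℕ-injective (nth-injective unique (bound i) (bound j) eq)
  ; exhaustive  = exhaustive
  ; adjacent    = adjacent
  ; reversal    = reversal
  }
  where
  σ = letters-from-3 k
  u₀ = reverse σ ++ 1 ∷ 2 ∷ []
  half = ws ∷ʳ (1 ∷ 2 ∷ σ)
  listing = half ++ map reverse half
  π : Fin ((2 + k) !) → Word
  π i = nth [] listing (toℕ i)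

  start-↭ : u₀ ↭ 1 ∷ 2 ∷ σ
  start-↭ = trans (++-comm (reverse σ) (1 ∷ 2 ∷ [])) (prep 1 (prep 2 (↭-reverse σ)))

  length-half : length half ≡ conCount k
  length-half = begin
    length half           ≡⟨ length-++ ws ⟩
    length ws + 1         ≡⟨ +-comm (length ws) 1 ⟩
    suc (length ws)       ≡⟨ count ⟩
    conCount (length σ)   ≡⟨ cong conCount (length-applyUpTo (λ i → 3 + i) k) ⟩
    conCount k            ∎
    where open ≡-Reasoning

  length-listing : length listing ≡ (2 + k) !
  length-listing = begin
    length listing                             ≡⟨ length-++ half ⟩
    length half + length (map reverse half)    ≡⟨ cong (length half +_) (length-map reverse half) ⟩
    length half + length half                  ≡⟨ cong₂ _+_ length-half length-half ⟩
    conCount k + conCount k                    ≡⟨ conCount-double k ⟩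
    (2 + k) !                                  ∎
    where open ≡-Reasoning

  half! : (2 + k) ! / 2 ≡ length half
  half! = begin
    (2 + k) ! / 2               ≡⟨ cong (_/ 2) (conCount-double k) ⟨
    (conCount k + conCount k) / 2   ≡⟨ cong (λ m → (conCount k + m) / 2) (+-identityʳ (conCount k)) ⟨
    2 * conCount k / 2          ≡⟨ cong (_/ 2) (*-comm 2 (conCount k)) ⟩
    conCount k * 2 / 2          ≡⟨ m*n/n≡m (conCount k) 2 ⟩
    conCount k                  ≡⟨ length-half ⟨
    length half                 ∎
    where open ≡-Reasoning

  bound : (i : Fin ((2 + k) !)) → toℕ i < length listing
  bound i = subst (toℕ i <_) (sym length-listing) (toℕ<n i)

  end-reversed : reverse u₀ ≡ 2 ∷ 1 ∷ σ
  end-reversed = ≡-trans (reverse-++ (reverse σ) (1 ∷ 2 ∷ [])) (cong (λ zs → 2 ∷ 1 ∷ zs) (reverse-involutive σ))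

  whole : Walk u₀ (reverse (1 ∷ 2 ∷ σ)) (half ++ map reverse ws)
  -- The two halves are linked by the interchange of 1 and 2 at the front: the reversal of the start
  -- is `2 ∷ 1 ∷ σ`.
  whole = (walk ▻ subst (AdjacentInterchange (1 ∷ 2 ∷ σ)) (sym end-reversed) interchange-first)
          ◅◅ walk-map reverse interchange-reverse walk

  listing-whole : (half ++ map reverse ws) ∷ʳ reverse (1 ∷ 2 ∷ σ) ≡ listing
  listing-whole = ≡-trans (++-assoc half _ _) (cong (half ++_) (sym (map-++ reverse ws _)))

  permutations : All (u₀ ↭_) listing
  permutations = subst (All (u₀ ↭_)) listing-whole (walk-↭ whole)

  covers : w ↭ 1 ∷ 2 ∷ σ → w ∈ listing
  covers {w} p with one-before-two p
  ... | inj₁ l = ∈-++⁺ˡ (complete l)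
  ... | inj₂ l = ∈-++⁺ʳ half (subst (_∈ map reverse half) (reverse-involutive w) (∈-map⁺ reverse (complete l)))

  vA : Valid (free (1 ∷ 2 ∷ σ))
  vA = valid (Unique.applyUpTo⁺₁ suc (2 + k) (λ i<j _ → <⇒≢ i<j ∘ suc-injective))

  unique : Unique listing
  -- The listing covers the repetition-free list of all permutations and has the same length, so it
  -- is a rearrangement of that list.
  unique = Unique-resp-↭ (unique-cover (words-unique (rank (free (1 ∷ 2 ∷ σ))) vA)
      (λ i → covers (lin-↭ (lin-words⁻ {free (1 ∷ 2 ∷ σ)} _ refl i)))
      (≡-trans length-listing (sym (≡-trans (words-length _ (free (1 ∷ 2 ∷ σ)) refl)
        (cong (λ n → (2 + n) !) (length-applyUpTo (λ i → 3 + i) k))))))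
    (words-unique (rank (free (1 ∷ 2 ∷ σ))) vA)

  exhaustive : ∀ w → IsPermutation (2 + k) w → ∃[ i ] π i ≡ w
  exhaustive w p with i , i<n , eq ← ∈-nth {z = []} (covers p) =
    fromℕ< (subst (i <_) length-listing i<n) , ≡-trans (cong (nth [] listing) (toℕ-fromℕ< _)) eq

  adjacent : ∀ i j → toℕ j ≡ suc (toℕ i) → AdjacentInterchange (π i) (π j)
  adjacent i j eq = subst₂ AdjacentInterchange
    (cong (λ l → nth [] l (toℕ i)) listing-whole)
    (≡-trans (cong (λ l → nth [] l (suc (toℕ i))) listing-whole) (cong (nth [] listing) (sym eq)))
    (walk-nth whole (s≤s⁻¹ (subst₂ _<_ eq last-index (bound j))))
    where
    last-index : length listing ≡ suc (length (half ++ map reverse ws))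
    last-index = ≡-trans (cong length (sym listing-whole))
      (≡-trans (length-++ (half ++ map reverse ws)) (+-comm _ 1))

  reversal : ∀ i j → toℕ i < (2 + k) ! / 2 → toℕ j ≡ toℕ i + (2 + k) ! / 2 → π j ≡ reverse (π i)
  reversal i j i<h eq = begin
    nth [] listing (toℕ j)                  ≡⟨ cong (nth [] listing) (≡-trans eq (cong (toℕ i +_) half!)) ⟩
    nth [] listing (toℕ i + length half)    ≡⟨ nth-++ʳ half (toℕ i) ⟩
    nth [] (map reverse half) (toℕ i)       ≡⟨ nth-map reverse half i<half ⟩
    reverse (nth [] half (toℕ i))           ≡⟨ cong reverse (nth-++ˡ half i<half) ⟨
    reverse (nth [] listing (toℕ i))        ∎
    where
    open ≡-Reasoning
    i<half : toℕ i < length half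
    i<half = subst (toℕ i <_) half! i<h

-- Necessity

-- The four added terms are n, n+1, n+2, n+3, whose parities cancel in pairs.
parity-triangular-4+ : ∀ n → parity (triangular (4 + n)) ≡ parity (triangular n)
parity-triangular-4+ n = begin
  parity ((3 + n) + ((2 + n) + ((1 + n) + (n + triangular n))))
    ≡⟨ ℙ.+-homo-+ (3 + n) _ ⟩
  y ℙ.+ parity ((2 + n) + ((1 + n) + (n + triangular n)))
    ≡⟨ cong (y ℙ.+_) (ℙ.+-homo-+ (2 + n) _) ⟩
  y ℙ.+ (x ℙ.+ parity ((1 + n) + (n + triangular n)))
    ≡⟨ cong (λ r → y ℙ.+ (x ℙ.+ r)) (ℙ.+-homo-+ (1 + n) _) ⟩
  y ℙ.+ (x ℙ.+ (y ℙ.+ parity (n + triangular n)))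
    ≡⟨ cong (λ r → y ℙ.+ (x ℙ.+ (y ℙ.+ r))) (ℙ.+-homo-+ n _) ⟩
  y ℙ.+ (x ℙ.+ (y ℙ.+ (x ℙ.+ parity (triangular n))))
    ≡⟨ cancel y x _ ⟩
  parity (triangular n) ∎
  where
  open ≡-Reasoning
  x = parity n
  y = parity (1 + n)
  cancel : ∀ x y r → x ℙ.+ (y ℙ.+ (x ℙ.+ (y ℙ.+ r))) ≡ r
  cancel 0ℙ 0ℙ r  = refl
  cancel 0ℙ 1ℙ r  = ℙ.⁻¹-involutive r
  cancel 1ℙ 0ℙ r  = ℙ.⁻¹-involutive r
  cancel 1ℙ 1ℙ 0ℙ = refl
  cancel 1ℙ 1ℙ 1ℙ = refl

parity-triangular : ∀ n → parity (triangular n) ≡ parity (triangular (n % 4))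
parity-triangular n = ≡-trans
  (cong (parity ∘ triangular) (≡-trans (m≡m%n+[m/n]*n n 4) (+-comm (n % 4) (n / 4 * 4))))
  (periodic (n / 4) (n % 4))
  where
  periodic : ∀ q r → parity (triangular (q * 4 + r)) ≡ parity (triangular r)
  periodic zero    r = refl
  periodic (suc q) r = ≡-trans (parity-triangular-4+ (q * 4 + r)) (periodic q r)

word-unique : ∀ n → Unique (applyUpTo suc n)
word-unique n = Unique.applyUpTo⁺₁ suc n (λ i<j _ → <⇒≢ i<j ∘ suc-injective)

-- The word at position n!/2 is compared with the first one in two ways: an even number of
-- interchanges keeps the sign, whereas the reversal changes it.
no-gray-code : ∀ n (π : Fin (n !) → Word) → IsReverseGrayCode n π → 4 ≤ n → parity (triangular n) ≢ 1ℙ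
no-gray-code n π code 4≤n odd = ℙ.p≢p⁻¹ (sign (π-at start<)) (begin
  sign (π-at start<)                                ≡⟨ even-half ⟨
  parity (n ! / 2) ℙ.+ sign (π-at start<)           ≡⟨ signs (n ! / 2) half< ⟨
  sign (π-at half<)                                 ≡⟨ cong sign reversed ⟩
  sign (reverse (π-at start<))                      ≡⟨ reverse-sign _ (unique start<) ⟩
  parity (triangular (length (π-at start<))) ℙ.+ _  ≡⟨ cong (λ m → parity (triangular m) ℙ.+ sign (π-at start<)) length-n ⟩
  parity (triangular n) ℙ.+ sign (π-at start<)      ≡⟨ cong (ℙ._+ sign (π-at start<)) odd ⟩
  sign (π-at start<) ⁻¹                             ∎)
  where
  open ≡-Reasoning
  open IsReverseGrayCode code
  instance
    n!≢0 = n !≢0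
  π-at : ∀ {k} → k < n ! → Word
  π-at k< = π (fromℕ< k<)
  half< : n ! / 2 < n !
  half< = m/n<m (n !) 2 (s≤s (s≤s z≤n))
  start< : 0 < n !
  start< = ≤-<-trans z≤n half<
  unique : ∀ {k} (k< : k < n !) → Unique (π-at k<)
  unique k< = Unique-resp-↭ (↭-sym (permutation (fromℕ< k<))) (word-unique n)
  length-n : length (π-at start<) ≡ n
  length-n = ≡-trans (↭-length (permutation (fromℕ< start<))) (length-applyUpTo suc n)
  signs : ∀ k (k< : k < n !) → sign (π-at k<) ≡ parity k ℙ.+ sign (π-at start<)
  signs zero    k< = refl
  signs (suc k) k< = begin
    sign (π-at k<)                              ≡⟨ interchange-sign (unique k<′) (adjacent _ _
                                                     (≡-trans (toℕ-fromℕ< k<) (cong suc (sym (toℕ-fromℕ< k<′))))) ⟩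
    sign (π-at k<′) ⁻¹                          ≡⟨ cong _⁻¹ (signs k k<′) ⟩
    (parity k ℙ.+ sign (π-at start<)) ⁻¹        ≡⟨ ⁻¹-+ (parity k) _ ⟨
    parity k ⁻¹ ℙ.+ sign (π-at start<)          ≡⟨ cong (ℙ._+ sign (π-at start<)) (parity-suc k) ⟨
    parity (suc k) ℙ.+ sign (π-at start<)       ∎
    where
    k<′ : k < n !
    k<′ = <-trans (n<1+n k) k<
  reversed : π-at half< ≡ reverse (π-at start<)
  -- Position 0 is within the bound because n!/2 is positive: 24 divides n!, so n! is at least 2.
  reversed = reversal (fromℕ< start<) (fromℕ< half<)
    (subst (_< n ! / 2) (sym (toℕ-fromℕ< start<)) (m≥n⇒m/n>0 (≤-trans (m≤m+n 2 22) (∣⇒≤ (m≤n⇒m!∣n! 4≤n)))))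
    (≡-trans (toℕ-fromℕ< half<) (cong (_+ n ! / 2) (sym (toℕ-fromℕ< start<))))
  even-half : parity (n ! / 2) ℙ.+ sign (π-at start<) ≡ sign (π-at start<)
  -- As 24 divides n!, its half is a multiple of 12.
  even-half with divides q eq ← m≤n⇒m!∣n! 4≤n = cong (ℙ._+ sign (π-at start<)) (begin
    parity (n ! / 2)          ≡⟨ cong (λ m → parity (m / 2)) (≡-trans eq (sym (*-assoc q 12 2))) ⟩
    parity (q * 12 * 2 / 2)   ≡⟨ cong parity (m*n/n≡m (q * 12) 2) ⟩
    parity (q * 12)           ≡⟨ ℙ.*-homo-* q 12 ⟩
    parity q ℙ.* 0ℙ           ≡⟨ ℙ.*-zeroʳ (parity q) ⟩
    0ℙ                        ∎)

-- Sufficiency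

-- By the parity hypothesis, reversing `1 ∷ 2 ∷ A` keeps its sign. The start is one interchange away
-- from this reversal, so the two ends have opposite signs, as `lace` demands.
con-tour : ∀ n A → length A ≡ 4 + n → Valid (con A) → parity (triangular (2 + length A)) ≡ 0ℙ →
           Tour (con A) (reverse A ++ 1 ∷ 2 ∷ []) (1 ∷ 2 ∷ A)
con-tour n A eq vA even = from (reverse A) (↭-reverse A)
  (lin-con (reverse A) [] [] (trans (++-comm (reverse A) []) (↭-reverse A))) opposite
  where
  good : ∀ {o} → o ∈ options (con A) → Versatile (proj₂ o) × parity (size (proj₂ o)) ≡ 0ℙ
  good (here refl) =
    proj₁ (free-good (suc n) (2 ∷ A) (cong suc eq) (distinct (option-valid vA (here refl)))) ,
    even-free {2 ∷ A} (s≤s (subst (1 ≤_) (sym eq) (s≤s z≤n)))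
  good (there p) with (c , B) , q , refl ← ∈-map⁻ _ p
    with eq′ ← suc-injective (≡-trans (choice-length q) eq) =
    con-versatile n B eq′ (option-valid vA (there p)) ,
    even-con {B} (≤-trans (m≤m+n 2 (1 + n)) (≤-reflexive (sym eq′)))
  reversed : reverse (1 ∷ 2 ∷ A) ≡ reverse A ++ 2 ∷ 1 ∷ []
  reversed = reverse-++ (1 ∷ 2 ∷ []) A
  opposite : sign (1 ∷ 2 ∷ A) ≡ sign (reverse A ++ 1 ∷ 2 ∷ []) ⁻¹
  opposite = begin
    sign (1 ∷ 2 ∷ A)                                             ≡⟨ cong (ℙ._+ sign (1 ∷ 2 ∷ A)) even ⟨
    parity (triangular (2 + length A)) ℙ.+ sign (1 ∷ 2 ∷ A)      ≡⟨ reverse-sign (1 ∷ 2 ∷ A) (distinct vA) ⟨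
    sign (reverse (1 ∷ 2 ∷ A))                                   ≡⟨ cong sign reversed ⟩
    sign (reverse A ++ 2 ∷ 1 ∷ [])                               ≡⟨ interchange-sign start-unique (reverse A , 1 , 2 , [] , refl , refl) ⟩
    sign (reverse A ++ 1 ∷ 2 ∷ []) ⁻¹                            ∎
    where
    open ≡-Reasoning
    start-unique : Unique (reverse A ++ 1 ∷ 2 ∷ [])
    start-unique = Unique-resp-↭
      (↭-sym (trans (++-comm (reverse A) (1 ∷ 2 ∷ [])) (prep 1 (prep 2 (↭-reverse A))))) (distinct vA)
  n≥5 : 5 ≤ length (options (con A))
  n≥5 = ≤-trans (m≤m+n 5 n) (≤-reflexive (sym (≡-trans (length-options-con A) (cong suc eq))))
  laceable : Laceable (free (2 ∷ A))
  laceable = proj₂ (free-good (suc n) (2 ∷ A) (cong suc eq) (distinct (option-valid vA (here refl))))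
  1∉A : ∀ {y} → y ∈ A → y ≢ 1
  1∉A i with (_ ∷ 1#) ∷ _ ← distinct vA = lookup 1# i ∘ sym
  -- The word `reverse A` is generalised to `B` in order to expose the first two letters of the
  -- start.
  from : ∀ B → B ↭ A → Lin (con A) (B ++ 1 ∷ 2 ∷ []) → sign (1 ∷ 2 ∷ A) ≡ sign (B ++ 1 ∷ 2 ∷ []) ⁻¹ →
         Tour (con A) (B ++ 1 ∷ 2 ∷ []) (1 ∷ 2 ∷ A)
  from [] r with () ← ≡-trans (↭-length r) eq
  from (_ ∷ []) r with () ← ≡-trans (↭-length r) eq
  from (y ∷ c ∷ B) r (cons p m) =
    -- The end starts with 1, so the class visited last is the unconstrained one, where laceability
    -- is available.
    lace vA (tabulate good) n≥5 p (here refl) (1∉A (∈-resp-↭ r (here refl))) laceable m (lin-free refl)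

-- Hamiltonian paths from rev σ 1 2 to 1 2 σ on n letters, for the cases below the reach of
-- `con-tour`. For n = 2 start and end coincide, and the path is empty.
path : ℕ → List ℕ
path 3 = 1 ∷ 2 ∷ []
path 4 = toNatDigits 10 12313213123
path 5 = toNatDigits 10 12121314123412342141312121421212314323213141312121412121312
path _ = []

abstract
  traced-2 : Traced (con []) (1 ∷ 2 ∷ []) (path 2)
  traced-2 = from-yes (traced? (con []) (1 ∷ 2 ∷ []) (path 2))

  traced-3 : Traced (con (3 ∷ [])) (3 ∷ 1 ∷ 2 ∷ []) (path 3)
  traced-3 = from-yes (traced? (con (3 ∷ [])) (3 ∷ 1 ∷ 2 ∷ []) (path 3))

  traced-4 : Traced (con (3 ∷ 4 ∷ [])) (4 ∷ 3 ∷ 1 ∷ 2 ∷ []) (path 4)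
  traced-4 = from-yes (traced? (con (3 ∷ 4 ∷ [])) (4 ∷ 3 ∷ 1 ∷ 2 ∷ []) (path 4))

  traced-5 : Traced con₅ (5 ∷ 4 ∷ 3 ∷ 1 ∷ 2 ∷ []) (path 5)
  traced-5 = from-yes (traced? con₅ (5 ∷ 4 ∷ 3 ∷ 1 ∷ 2 ∷ []) (path 5))

gray-code-1 : ∃[ π ] IsReverseGrayCode 1 π
gray-code-1 = (λ _ → 1 ∷ []) , record
  { permutation = λ _ → refl
  ; injective   = λ { {Fin.zero} {Fin.zero} _ → refl }
  ; exhaustive  = λ _ p → Fin.zero , sym (↭-singleton-inv p)
  ; adjacent    = λ { Fin.zero Fin.zero () }
  ; reversal    = λ { _ _ () }
  }

gray-code-exists : ∀ n → 1 ≤ n → n ≤ 4 ⊎ parity (triangular n) ≡ 0ℙ → ∃[ π ] IsReverseGrayCode n π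
gray-code-exists 1 _ _ = gray-code-1
gray-code-exists 2 _ _ = gray-code 0 (renamed-tour {R = con []} id refl refl traced-2)
gray-code-exists 3 _ _ = gray-code 1 (renamed-tour {R = con (3 ∷ [])} id refl refl traced-3)
gray-code-exists 4 _ _ = gray-code 2 (renamed-tour {R = con (3 ∷ 4 ∷ [])} id refl refl traced-4)
gray-code-exists 5 _ _ = gray-code 3 (renamed-tour {R = con₅} id refl refl traced-5)
gray-code-exists (suc (suc (suc (suc (suc (suc n)))))) _ (inj₁ (s≤s (s≤s (s≤s (s≤s ())))))
gray-code-exists (suc (suc (suc (suc (suc (suc n)))))) _ (inj₂ even) =
  gray-code (4 + n) (con-tour n (letters-from-3 (4 + n)) len (valid (word-unique (6 + n)))
    (subst (λ k → parity (triangular (2 + k)) ≡ 0ℙ) (sym len) even))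
  where
  len : length (letters-from-3 (4 + n)) ≡ 4 + n
  len = length-applyUpTo (λ i → 3 + i) (4 + n)

theorem7 : (n : ℕ) → 1 ≤ n →
    (∃[ π ] IsReverseGrayCode n π) ⇔ (n ≤ 4 ⊎ (n % 4 ≡ 0 ⊎ n % 4 ≡ 1))
theorem7 n 1≤n = mk⇔ (necessary n) (gray-code-exists n 1≤n ∘ even)
  where
  even : n ≤ 4 ⊎ (n % 4 ≡ 0 ⊎ n % 4 ≡ 1) → n ≤ 4 ⊎ parity (triangular n) ≡ 0ℙ
  even (inj₁ n≤4)       = inj₁ n≤4
  even (inj₂ (inj₁ eq)) = inj₂ (≡-trans (parity-triangular n) (cong (parity ∘ triangular) eq))
  even (inj₂ (inj₂ eq)) = inj₂ (≡-trans (parity-triangular n) (cong (parity ∘ triangular) eq))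
  necessary : ∀ n → ∃[ π ] IsReverseGrayCode n π → n ≤ 4 ⊎ (n % 4 ≡ 0 ⊎ n % 4 ≡ 1)
  necessary n (π , code) with n ≤? 4
  ... | yes n≤4 = inj₁ n≤4
  ... | no  n≰4 = inj₂ (residue (n % 4) (m%n<n n 4) λ odd →
    no-gray-code n π code (<⇒≤ (≰⇒> n≰4)) (≡-trans (parity-triangular n) odd))
    where
    -- The values of `triangular` at 0, 1, 2, 3 are 0, 0, 1, 3.
    residue : ∀ r → r < 4 → parity (triangular r) ≢ 1ℙ → r ≡ 0 ⊎ r ≡ 1
    residue 0 _ _ = inj₁ refl
    residue 1 _ _ = inj₂ refl
    residue 2 _ neq = contradiction refl neq
    residue 3 _ neq = contradiction refl neq
    residue (suc (suc (suc (suc _)))) (s≤s (s≤s (s≤s (s≤s ())))) _
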